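{- Let $n\ge 2$ and $S_n^2=S_n\times K_2$. Then (1) $Kf(S_n^2)=\dfrac{8n^3+3n^2-14n+12}{3n+6}$; (2) $\tau(S_n^2)=(n+2)\cdot 3^{n-2}$; (3) $\displaystyle\lim_{n\to+\infty}\frac{Kf(S_n^2)}{W(S_n^2)}=\frac{8}{15}$.
   Context: $S_n$ is the star of order $n$, $K_2$ the complete graph on two vertices, and $S_n\times K_2$ their Cartesian product (vertex set $V(S_n)\times V(K_2)$, with $(u_1,v_1)\sim(u_2,v_2)$ iff ($u_1=u_2$ and $v_1v_2\in E(K_2)$) or ($v_1=v_2$ and $u_1u_2\in E(S_n)$)). For a connected graph $G$: the resistance distance $r_{ij}$ between vertices $v_i,v_j$ is the effective resistance between them when every edge is a unit resistor; the Kirchhoff index is $Kf(G)=\sum_{i<j}r_{ij}$; the Wiener index is $W(G)=\sum_{i<j}d_{ij}$, where $d_{ij}$ is the graph distance; $\tau(G)$ is the number of spanning trees of $G$. -}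

module Defs where

open import Data.Bool using (Bool; true; false; _∧_; _∨_; if_then_else_)
open import Data.Nat as ℕ using (ℕ; zero; suc; _∸_; _≡ᵇ_)
open import Data.Fin as Fin using (Fin; zero; suc; splitAt; toℕ)
open import Data.Fin.Properties using (_≟_)
open import Data.Sum using (inj₁; inj₂)
open import Data.Product using (Σ; _×_; _,_; proj₁; proj₂; ∃)
open import Data.List using (List; []; _∷_; length; map; allFin; filterᵇ; concatMap; foldr)
open import Data.Bool.ListAction using (any; all)
open import Data.Integer using (ℤ; +_)
open import Data.Rational using (ℚ; 0ℚ; 1ℚ; _+_; _-_; _*_; _/_)
open import Relation.Nullary using (¬_)
open import Relation.Nullary.Decidable using (⌊_⌋)
open import Relation.Binary.PropositionalEquality using (_≡_)

Graph : ℕ → Set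
Graph N = Fin N → Fin N → Bool

star : (n : ℕ) → Graph n
star n zero    (suc _) = true
star n (suc _) zero    = true
star n _       _       = false

-- Cartesian product G × K_2.  Vertex (u , 0) is encoded as u ↑ˡ n, (u , 1) as n ↑ʳ u.
_×K₂ : {n : ℕ} → Graph n → Graph (n ℕ.+ n)
_×K₂ {n} G a b with splitAt n a | splitAt n b
... | inj₁ u | inj₁ v = G u v
... | inj₂ u | inj₂ v = G u v
... | inj₁ u | inj₂ v = ⌊ u ≟ v ⌋
... | inj₂ u | inj₁ v = ⌊ u ≟ v ⌋

S² : (n : ℕ) → Graph (n ℕ.+ n)
S² n = star n ×K₂

sumℚ : List ℚ → ℚ
sumℚ = foldr _+_ 0ℚ

sumℕ : List ℕ → ℕ
sumℕ = foldr ℕ._+_ 0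

sumPairsℚ : {N : ℕ} → (Fin N → Fin N → ℚ) → ℚ
sumPairsℚ {N} f = sumℚ (map (λ i → sumℚ (map (λ j → if toℕ i ℕ.<ᵇ toℕ j then f i j else 0ℚ) (allFin N))) (allFin N))

sumPairsℕ : {N : ℕ} → (Fin N → Fin N → ℕ) → ℕ
sumPairsℕ {N} f = sumℕ (map (λ i → sumℕ (map (λ j → if toℕ i ℕ.<ᵇ toℕ j then f i j else 0) (allFin N))) (allFin N))

lap : {N : ℕ} → Graph N → (Fin N → ℚ) → Fin N → ℚ
lap {N} G x v = sumℚ (map (λ u → if G v u then x v - x u else 0ℚ) (allFin N))

δ : {N : ℕ} → Fin N → Fin N → ℚ
δ i v = if ⌊ i ≟ v ⌋ then 1ℚ else 0ℚ

-- r is the effective resistance between i and j: inject unit current at i, extract it at j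
-- (Kirchhoff's current law L x = e_i - e_j, Ohm's law on each unit edge); r is the potential drop.
IsResistance : {N : ℕ} → Graph N → Fin N → Fin N → ℚ → Set
IsResistance G i j r = Σ (_ → ℚ) λ x → ((v : _) → lap G x v ≡ δ i v - δ j v) × (r ≡ x i - x j)

IsKirchhoffIndex : {N : ℕ} → Graph N → ℚ → Set
IsKirchhoffIndex {N} G k =
  Σ (Fin N → Fin N → ℚ) λ r → ((i j : Fin N) → IsResistance G i j (r i j)) × (k ≡ sumPairsℚ r)

data Walk {N : ℕ} (G : Graph N) : Fin N → Fin N → ℕ → Set where
  here : ∀ {u} → Walk G u u 0
  step : ∀ {u w v k} → G u w ≡ true → Walk G w v k → Walk G u v (suc k)

IsDistance : {N : ℕ} → Graph N → Fin N → Fin N → ℕ → Set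
IsDistance G u v d = Walk G u v d × ((k : ℕ) → k ℕ.< d → ¬ Walk G u v k)

IsWienerIndex : {N : ℕ} → Graph N → ℕ → Set
IsWienerIndex {N} G w =
  Σ (Fin N → Fin N → ℕ) λ d → ((u v : Fin N) → IsDistance G u v (d u v)) × (w ≡ sumPairsℕ d)

edges : {N : ℕ} → Graph N → List (Fin N × Fin N)
edges {N} G = concatMap (λ i → concatMap (λ j → if (toℕ i ℕ.<ᵇ toℕ j) ∧ G i j then (i , j) ∷ [] else []) (allFin N)) (allFin N)

sublists : {A : Set} → List A → List (List A)
sublists []       = [] ∷ []
sublists (x ∷ xs) = let s = sublists xs in s Data.List.++ map (x ∷_) s

reachStep : {N : ℕ} → List (Fin N × Fin N) → (Fin N → Bool) → Fin N → Bool
reachStep T S v = S v ∨ any (λ e → (S (proj₁ e) ∧ ⌊ v ≟ proj₂ e ⌋) ∨ (S (proj₂ e) ∧ ⌊ v ≟ proj₁ e ⌋)) T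

reach : {N : ℕ} → List (Fin N × Fin N) → ℕ → (Fin N → Bool) → Fin N → Bool
reach T zero    S = S
reach T (suc k) S = reach T k (reachStep T S)

connectedᵇ : {N : ℕ} → List (Fin N × Fin N) → Bool
connectedᵇ {N} T = all (λ u → all (λ v → reach T N (λ w → ⌊ u ≟ w ⌋) v) (allFin N)) (allFin N)

isSpanningTreeᵇ : {N : ℕ} → List (Fin N × Fin N) → Bool
isSpanningTreeᵇ {N} T = (length T ≡ᵇ (N ∸ 1)) ∧ connectedᵇ T

τ : {N : ℕ} → Graph N → ℕ
τ G = length (filterᵇ isSpanningTreeᵇ (sublists (edges G)))

-- ratio of a rational by a natural (only used with a nonzero denominator)
_÷ℕ_ : ℚ → ℕ → ℚ
k ÷ℕ zero    = 0ℚ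
k ÷ℕ (suc m) = k * (+ 1 / suc m)

{-# OPTIONS --safe #-}
module Submission where

-- Write n = m + 1.  S² n is a book of m quadrilateral pages glued along the edge joining the
-- two centres ("spine").
--
-- Kirchhoff index: there is an explicit g with L g_u = e_u − h, h independent of u, so
-- g_u − g_v is the potential of a unit current from u to v, and summing the potential drops
-- over all pairs gives Kf = N tr g − Σ g.  Since L is self-adjoint, any two potentials of the
-- same current have the same drop, hence resistances are unique.
--
-- Spanning trees: outside the spine every page is a path of three edges between the centres.
-- A connected edge set keeps at least two edges of each page, so with 2n − 1 edges it is a
-- tree exactly when, besides two edges of each page, it has a single further edge: the
-- spine (3^m choices) or the third edge of one page (m 3^(m−1) choices).
--
-- Limit: W = n² + 4m², and Kf / W − 8/15 has numerator −3n² + 78n − 12 over 15 (3n + 6) W,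
-- hence is O(1/n).

-- The limit is claimed for every `k` and `w` that satisfy the index predicates, so closed forms
-- alone do not give it: resistances and distances must be unique before the explicit values can be
-- substituted. A potential may be shifted by a constant, so uniqueness concerns its drops. The
-- vector h is forced because the Laplacian of an undirected graph only produces vectors of sum
-- zero. The value 8/15 is the ratio of the leading terms 8n³/(3n) and 5n². For trees, `τ`
-- enumerates sublists of a list ordered by vertex index, in which edges come kind by kind, whereas
-- trees are recognised page by page. Sublists are therefore encoded by one bit mask per kind of
-- edge, and the three mask sums are peeled one page at a time. The test for a tree is size plus
-- connectivity, so edges are counted instead of looking for cycles. Connectivity means reachability
-- within N rounds: proving it requires shortening walks by the pigeonhole principle, and refuting
-- it requires a vertex set that no chosen edge leaves.

open import Defs

-- Finite sums in commutative monoids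

module FiniteSums where
  open import Algebra.Structures using (IsCommutativeMonoid)
  open import Algebra.Bundles using (CommutativeMonoid)
  open import Data.Bool using (true; false; if_then_else_)
  open import Data.Fin using (Fin; zero; suc; toℕ; _↑ˡ_; _↑ʳ_)
  open import Data.Fin.Properties using (_≟_; <-cmp)
  open import Data.List using (foldr; map; allFin; tabulate)
  open import Data.List.Properties using (map-tabulate)
  import Data.Nat as ℕ
  open import Data.Nat.Properties using (<⇒<ᵇ; <ᵇ⇒<)
  open import Data.Bool.Properties using (T-≡)
  open import Function using (_∘_; Equivalence)
  open import Level using (0ℓ)
  open import Relation.Binary.Definitions using (tri<; tri≈; tri>)
  open import Relation.Binary.PropositionalEquality
  open import Relation.Nullary using (¬_; yes; no; contradiction)
  open import Relation.Nullary.Decidable using (⌊_⌋)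

  <⇒<ᵇ≡true : ∀ {m n} → m ℕ.< n → (m ℕ.<ᵇ n) ≡ true
  <⇒<ᵇ≡true m<n = Equivalence.to T-≡ (<⇒<ᵇ m<n)

  ≮⇒<ᵇ≡false : ∀ {m n} → ¬ m ℕ.< n → (m ℕ.<ᵇ n) ≡ false
  ≮⇒<ᵇ≡false {m} {n} m≮n with m ℕ.<ᵇ n in eq
  ... | false = refl
  ... | true  = contradiction (<ᵇ⇒< m n (Equivalence.from T-≡ eq)) m≮n

  module _ {A : Set} {_∙_ : A → A → A} {ε : A} (isCM : IsCommutativeMonoid _≡_ _∙_ ε) where
    private
      M : CommutativeMonoid 0ℓ 0ℓ
      M = record { isCommutativeMonoid = isCM }
    open CommutativeMonoid M using (assoc; identityˡ; identityʳ)
    open import Algebra.Properties.CommutativeMonoid.Sum M using (sum; sum-cong-≗; sum-replicate-zero; ∑-comm; ∑-distrib-+)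

    foldr-allFin : ∀ {n} (f : Fin n → A) → foldr _∙_ ε (map f (allFin n)) ≡ sum f
    foldr-allFin f = trans (cong (foldr _∙_ ε) (map-tabulate (λ i → i) f)) (foldr-tabulate f)
      where
      foldr-tabulate : ∀ {n} (g : Fin n → A) → foldr _∙_ ε (tabulate g) ≡ sum g
      foldr-tabulate {ℕ.zero}  g = refl
      foldr-tabulate {ℕ.suc n} g = cong (g zero ∙_) (foldr-tabulate (g ∘ suc))

    sum-+ : ∀ m n (f : Fin (m ℕ.+ n) → A) → sum f ≡ sum (λ i → f (i ↑ˡ n)) ∙ sum (λ i → f (m ↑ʳ i))
    sum-+ ℕ.zero    n f = sym (identityˡ _)
    sum-+ (ℕ.suc m) n f = trans (cong (f zero ∙_) (sum-+ m n (f ∘ suc))) (sym (assoc _ _ _))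

    sum-δ : ∀ {n} (i : Fin n) (f : Fin n → A) → sum (λ j → if ⌊ i ≟ j ⌋ then f j else ε) ≡ f i
    sum-δ {ℕ.suc n} zero f = trans (cong (f zero ∙_) (sum-replicate-zero n)) (identityʳ _)
    sum-δ (suc i) f = trans (identityˡ _) (trans (sum-cong-≗ suc-δ) (sum-δ i (f ∘ suc)))
      where
      suc-δ : ∀ j → (if ⌊ suc i ≟ suc j ⌋ then f (suc j) else ε) ≡ (if ⌊ i ≟ j ⌋ then f (suc j) else ε)
      suc-δ j with i ≟ j
      ... | yes _ = refl
      ... | no  _ = refl

    -- The sum over i < j and its transpose together meet each off-diagonal ordered pair once, and
    -- the diagonal is neutral. The raw folds match both `sumPairsℚ` and `sumPairsℕ` by unfolding;
    -- stating the double avoids halving in a general monoid.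
    sum-pairs : ∀ {n} (f : Fin n → Fin n → A) →
                (∀ i j → f i j ≡ f j i) → (∀ i → f i i ≡ ε) →
                let s = foldr _∙_ ε (map (λ i → foldr _∙_ ε (map (λ j → if toℕ i ℕ.<ᵇ toℕ j then f i j else ε) (allFin n))) (allFin n))
                in s ∙ s ≡ sum (λ i → sum (f i))
    sum-pairs {n} f f-sym f-diag = begin
      s ∙ s                                                          ≡⟨ cong₂ _∙_ s≡ s≡ ⟩
      sum (λ i → sum (g i)) ∙ sum (λ i → sum (g i))                  ≡⟨ cong (sum (λ i → sum (g i)) ∙_) (∑-comm g) ⟩
      sum (λ i → sum (g i)) ∙ sum (λ i → sum (λ j → g j i))          ≡⟨ ∑-distrib-+ (λ i → sum (g i)) (λ i → sum (λ j → g j i)) ⟨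
      sum (λ i → sum (g i) ∙ sum (λ j → g j i))                      ≡⟨ sum-cong-≗ (λ i → ∑-distrib-+ (g i) (λ j → g j i)) ⟨
      sum (λ i → sum (λ j → g i j ∙ g j i))                          ≡⟨ sum-cong-≗ (λ i → sum-cong-≗ (split i)) ⟨
      sum (λ i → sum (f i))                                          ∎
      where
      open ≡-Reasoning
      g : Fin n → Fin n → A
      g i j = if toℕ i ℕ.<ᵇ toℕ j then f i j else ε
      s = foldr _∙_ ε (map (λ i → foldr _∙_ ε (map (g i) (allFin n))) (allFin n))
      s≡ : s ≡ sum (λ i → sum (g i))
      s≡ = trans (foldr-allFin (λ i → foldr _∙_ ε (map (g i) (allFin n)))) (sum-cong-≗ (λ i → foldr-allFin (g i)))
      split : ∀ i j → f i j ≡ g i j ∙ g j i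
      split i j with <-cmp i j
      ... | tri< i<j _ j≮i rewrite <⇒<ᵇ≡true i<j | ≮⇒<ᵇ≡false j≮i = sym (identityʳ _)
      ... | tri> i≮j _ j<i rewrite <⇒<ᵇ≡true j<i | ≮⇒<ᵇ≡false i≮j = trans (f-sym i j) (sym (identityˡ _))
      ... | tri≈ i≮i refl _ rewrite ≮⇒<ᵇ≡false i≮i = trans (f-diag i) (sym (identityˡ _))

-- The two copies of a graph inside its product with K₂

module TwoCopies where
  open import Data.Bool using (true; false)
  open import Data.Fin using (Fin; zero; suc; _↑ˡ_; _↑ʳ_; splitAt; join)
  open import Data.Fin.Properties using (_≟_; splitAt-↑ˡ; splitAt-↑ʳ; join-splitAt)
  open import Data.Nat using (ℕ; _+_)
  open import Data.Sum using (inj₁; inj₂)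
  open import Relation.Binary.PropositionalEquality
  open import Relation.Nullary using (yes; no; contradiction)
  open import Relation.Nullary.Decidable using (⌊_⌋)

  lo hi : ∀ {n} → Fin n → Fin (n + n)
  lo {n} u = u ↑ˡ n
  hi {n} u = n ↑ʳ u

  -- A view of the vertices: matching on it replaces an arbitrary index by `lo u` or `hi u`, the
  -- forms to which the rules for `splitAt` apply.
  data Copy (n : ℕ) : Fin (n + n) → Set where
    isLo : ∀ (u : Fin n) → Copy n (lo u)
    isHi : ∀ (u : Fin n) → Copy n (hi u)

  copy : ∀ n (v : Fin (n + n)) → Copy n v
  copy n v = subst (Copy n) (join-splitAt n n v) (copy-join (splitAt n v))
    where
    copy-join : ∀ s → Copy n (join n n s)
    copy-join (inj₁ u) = isLo u
    copy-join (inj₂ u) = isHi u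

  module _ {n : ℕ} (G : Graph n) where
    ×K₂-lo-lo : ∀ u v → (G ×K₂) (lo u) (lo v) ≡ G u v
    ×K₂-lo-lo u v rewrite splitAt-↑ˡ n u n | splitAt-↑ˡ n v n = refl

    ×K₂-hi-hi : ∀ u v → (G ×K₂) (hi u) (hi v) ≡ G u v
    ×K₂-hi-hi u v rewrite splitAt-↑ʳ n n u | splitAt-↑ʳ n n v = refl

    ×K₂-lo-hi : ∀ u v → (G ×K₂) (lo u) (hi v) ≡ ⌊ u ≟ v ⌋
    ×K₂-lo-hi u v rewrite splitAt-↑ˡ n u n | splitAt-↑ʳ n n v = refl

    ×K₂-hi-lo : ∀ u v → (G ×K₂) (hi u) (lo v) ≡ ⌊ u ≟ v ⌋
    ×K₂-hi-lo u v rewrite splitAt-↑ʳ n n u | splitAt-↑ˡ n v n = refl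

  ⌊≟⌋-refl : ∀ {n} (u : Fin n) → ⌊ u ≟ u ⌋ ≡ true
  ⌊≟⌋-refl u with u ≟ u
  ... | yes _ = refl
  ... | no u≢u = contradiction refl u≢u

  ⌊≟⌋-sym : ∀ {n} (u v : Fin n) → ⌊ u ≟ v ⌋ ≡ ⌊ v ≟ u ⌋
  ⌊≟⌋-sym u v with u ≟ v | v ≟ u
  ... | yes _   | yes _   = refl
  ... | no  _   | no  _   = refl
  ... | yes u≡v | no v≢u  = contradiction (sym u≡v) v≢u
  ... | no u≢v  | yes v≡u = contradiction (sym v≡u) u≢v

  ⌊≟⌋-≢ : ∀ {n} {u v : Fin n} → u ≢ v → ⌊ u ≟ v ⌋ ≡ false
  ⌊≟⌋-≢ {u = u} {v} u≢v with u ≟ v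
  ... | yes u≡v = contradiction u≡v u≢v
  ... | no  _   = refl

  ⌊≟⌋-injective : ∀ {m n} (f : Fin m → Fin n) → (∀ {u v} → f u ≡ f v → u ≡ v) → ∀ u v → ⌊ f u ≟ f v ⌋ ≡ ⌊ u ≟ v ⌋
  ⌊≟⌋-injective f f-inj u v with u ≟ v
  ... | yes refl = ⌊≟⌋-refl (f u)
  ... | no  u≢v  = ⌊≟⌋-≢ (λ eq → u≢v (f-inj eq))

  lo≢hi : ∀ {n} {u v : Fin n} → lo u ≢ hi v
  lo≢hi {n} {u} {v} eq with trans (sym (splitAt-↑ˡ n u n)) (trans (cong (splitAt n) eq) (splitAt-↑ʳ n n v))
  ... | ()

  star-sym : ∀ n u v → star n u v ≡ star n v u
  star-sym n zero zero = refl
  star-sym n zero (suc v) = refl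
  star-sym n (suc u) zero = refl
  star-sym n (suc u) (suc v) = refl

  S²-sym : ∀ n u v → S² n u v ≡ S² n v u
  S²-sym n u v with splitAt n u | splitAt n v
  ... | inj₁ i | inj₁ j = star-sym n i j
  ... | inj₂ i | inj₂ j = star-sym n i j
  ... | inj₁ i | inj₂ j = ⌊≟⌋-sym i j
  ... | inj₂ i | inj₁ j = ⌊≟⌋-sym i j

-- Integers inside the rationals and clearing of denominators

module Rationals where
  open import Data.Integer as ℤ using (ℤ; +_)
  import Data.Integer.Properties as ℤ
  open import Data.Nat as ℕ using (ℕ; suc)
  open import Data.Rational
  open import Data.Rational.Properties
  import Data.Rational.Unnormalised as ℚᵘ
  import Data.Rational.Unnormalised.Properties as ℚᵘ
  open import Relation.Binary.PropositionalEquality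

  -- `_/_` normalises by a gcd and so gets stuck on variables. In unnormalised rationals the
  -- numerator and denominator stay as written, and an equation becomes a cross multiplication.
  toℚᵘ-/ : ∀ z d → toℚᵘ (z / suc d) ℚᵘ.≃ ℚᵘ.mkℚᵘ z d
  toℚᵘ-/ z d = toℚᵘ-fromℚᵘ (ℚᵘ.mkℚᵘ z d)

  fromℤ : ℤ → ℚ
  fromℤ z = z / 1

  fromℕ : ℕ → ℚ
  fromℕ n = fromℤ (+ n)

  fromℤ-+ : ∀ x y → fromℤ (x ℤ.+ y) ≡ fromℤ x + fromℤ y
  fromℤ-+ x y = toℚᵘ-injective (begin
    toℚᵘ (fromℤ (x ℤ.+ y))                  ≈⟨ toℚᵘ-/ (x ℤ.+ y) 0 ⟩
    ℚᵘ.mkℚᵘ (x ℤ.+ y) 0                     ≈⟨ ℚᵘ.*≡* (cong (ℤ._* + 1) (cong₂ ℤ._+_ (sym (ℤ.*-identityʳ x)) (sym (ℤ.*-identityʳ y)))) ⟩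
    ℚᵘ.mkℚᵘ x 0 ℚᵘ.+ ℚᵘ.mkℚᵘ y 0            ≈⟨ ℚᵘ.+-cong (toℚᵘ-/ x 0) (toℚᵘ-/ y 0) ⟨
    toℚᵘ (fromℤ x) ℚᵘ.+ toℚᵘ (fromℤ y)      ≈⟨ toℚᵘ-homo-+ (fromℤ x) (fromℤ y) ⟨
    toℚᵘ (fromℤ x + fromℤ y)                ∎)
    where open ℚᵘ.≃-Reasoning

  fromℤ-* : ∀ x y → fromℤ (x ℤ.* y) ≡ fromℤ x * fromℤ y
  fromℤ-* x y = toℚᵘ-injective (begin
    toℚᵘ (fromℤ (x ℤ.* y))                  ≈⟨ toℚᵘ-/ (x ℤ.* y) 0 ⟩
    ℚᵘ.mkℚᵘ x 0 ℚᵘ.* ℚᵘ.mkℚᵘ y 0            ≈⟨ ℚᵘ.*-cong (toℚᵘ-/ x 0) (toℚᵘ-/ y 0) ⟨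
    toℚᵘ (fromℤ x) ℚᵘ.* toℚᵘ (fromℤ y)      ≈⟨ toℚᵘ-homo-* (fromℤ x) (fromℤ y) ⟨
    toℚᵘ (fromℤ x * fromℤ y)                ∎)
    where open ℚᵘ.≃-Reasoning

  fromℤ-neg : ∀ x → fromℤ (ℤ.- x) ≡ - fromℤ x
  fromℤ-neg x = toℚᵘ-injective (begin
    toℚᵘ (fromℤ (ℤ.- x))                    ≈⟨ toℚᵘ-/ (ℤ.- x) 0 ⟩
    ℚᵘ.- ℚᵘ.mkℚᵘ x 0                        ≈⟨ ℚᵘ.-‿cong (toℚᵘ-/ x 0) ⟨
    ℚᵘ.- toℚᵘ (fromℤ x)                     ≈⟨ toℚᵘ-homo‿- (fromℤ x) ⟨
    toℚᵘ (- fromℤ x)                        ∎)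
    where open ℚᵘ.≃-Reasoning

  fromℕ-+ : ∀ m n → fromℕ (m ℕ.+ n) ≡ fromℕ m + fromℕ n
  fromℕ-+ m n = fromℤ-+ (+ m) (+ n)

  fromℕ-* : ∀ m n → fromℕ (m ℕ.* n) ≡ fromℕ m * fromℕ n
  fromℕ-* m n = trans (cong fromℤ (ℤ.pos-* m n)) (fromℤ-* (+ m) (+ n))

  /-*-cancel : ∀ z d → (z / suc d) * fromℕ (suc d) ≡ fromℤ z
  /-*-cancel z d = toℚᵘ-injective (begin
    toℚᵘ ((z / suc d) * fromℕ (suc d))             ≈⟨ toℚᵘ-homo-* (z / suc d) (fromℕ (suc d)) ⟩
    toℚᵘ (z / suc d) ℚᵘ.* toℚᵘ (fromℕ (suc d))     ≈⟨ ℚᵘ.*-cong (toℚᵘ-/ z d) (toℚᵘ-/ (+ suc d) 0) ⟩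
    ℚᵘ.mkℚᵘ z d ℚᵘ.* ℚᵘ.mkℚᵘ (+ suc d) 0           ≈⟨ ℚᵘ.*≡* (ℤ.*-assoc z (+ suc d) (+ 1)) ⟩
    ℚᵘ.mkℚᵘ z 0                                    ≈⟨ toℚᵘ-/ z 0 ⟨
    toℚᵘ (fromℤ z)                                 ∎)
    where open ℚᵘ.≃-Reasoning

  *-cancelʳ-fromℕ : ∀ d {p q} → p * fromℕ (suc d) ≡ q * fromℕ (suc d) → p ≡ q
  *-cancelʳ-fromℕ d {p} {q} eq = begin
    p                                             ≡⟨ expand p ⟩
    p * fromℕ (suc d) * (+ 1 / suc d)             ≡⟨ cong (_* (+ 1 / suc d)) eq ⟩
    q * fromℕ (suc d) * (+ 1 / suc d)             ≡⟨ expand q ⟨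
    q                                             ∎
    where
    open ≡-Reasoning
    expand : ∀ x → x ≡ x * fromℕ (suc d) * (+ 1 / suc d)
    expand x = sym (trans (*-assoc x _ _) (trans (cong (x *_) (trans (*-comm (fromℕ (suc d)) _) (/-*-cancel (+ 1) d))) (*-identityʳ x)))

  -- Lets a closed form be verified with its denominator cleared, so that only a ring identity
  -- remains.
  ≡-/ : ∀ z d {k} → k * fromℕ (suc d) ≡ fromℤ z → k ≡ z / suc d
  ≡-/ z d eq = *-cancelʳ-fromℕ d (trans eq (sym (/-*-cancel z d)))

-- The graph Laplacian, its self-adjointness and uniqueness of resistances

module Laplacian where
  open import Algebra.Bundles using (CommutativeRing)
  open import Data.Bool using (true; false; if_then_else_)
  open import Data.Fin using (Fin; zero; suc; toℕ)
  open import Data.Fin.Properties using (_≟_)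
  open import Data.List.Properties using (map-cong)
  open import Data.List using (allFin)
  open import Data.Nat as ℕ using (ℕ; suc)
  open import Data.Product using (_,_)
  open import Data.Rational using (ℚ; 0ℚ; 1ℚ; _+_; _*_; _-_; -_)
  open import Data.Rational.Properties hiding (_≟_)
  open import Data.Rational.Solver using (module +-*-Solver)
  open import Function using (_∘_)
  open import Relation.Binary.PropositionalEquality
  open import Relation.Nullary.Decidable using (⌊_⌋)
  open import Algebra.Properties.Semiring.Sum (CommutativeRing.semiring +-*-commutativeRing) public
    using (sum; sum-cong-≗; ∑-comm; ∑-distrib-+; *-distribˡ-sum)
  open Rationals
  open FiniteSums
  open TwoCopies
  open ≡-Reasoning

  sum-neg : ∀ {n} (f : Fin n → ℚ) → sum (λ i → - f i) ≡ - sum f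
  sum-neg {ℕ.zero}  f = refl
  sum-neg {ℕ.suc n} f = trans (cong (- f zero +_) (sum-neg (f ∘ suc))) (sym (neg-distrib-+ (f zero) _))

  sum-minus : ∀ {n} (f g : Fin n → ℚ) → sum (λ i → f i - g i) ≡ sum f - sum g
  sum-minus f g = trans (∑-distrib-+ f (λ i → - g i)) (cong (sum f +_) (sum-neg g))

  sum-const : ∀ n c → sum {n} (λ _ → c) ≡ fromℕ n * c
  sum-const ℕ.zero    c = sym (*-zeroˡ c)
  sum-const (ℕ.suc n) c = begin
    c + sum {n} (λ _ → c)      ≡⟨ cong (c +_) (sum-const n c) ⟩
    c + fromℕ n * c            ≡⟨ solve 2 (λ c x → c :+ x :* c := (con 1ℚ :+ x) :* c) refl c (fromℕ n) ⟩
    (1ℚ + fromℕ n) * c         ≡⟨ cong (_* c) (fromℕ-+ 1 n) ⟨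
    fromℕ (suc n) * c          ∎
    where open +-*-Solver

  sum-*-δ : ∀ {n} (i : Fin n) (f : Fin n → ℚ) → sum (λ v → f v * δ i v) ≡ f i
  sum-*-δ i f = trans (sum-cong-≗ pointwise) (sum-δ +-0-isCommutativeMonoid i f)
    where
    pointwise : ∀ v → f v * δ i v ≡ (if ⌊ i ≟ v ⌋ then f v else 0ℚ)
    pointwise v with ⌊ i ≟ v ⌋
    ... | true  = *-identityʳ (f v)
    ... | false = *-zeroʳ (f v)

  -- The leaf rows of the potentials used later have this form.
  sum-affine-δ : ∀ {n} (i : Fin n) c d → sum (λ v → c + d * δ i v) ≡ fromℕ n * c + d
  sum-affine-δ {n} i c d = trans (∑-distrib-+ (λ _ → c) (λ v → d * δ i v)) (cong₂ _+_ (sum-const n c) (sum-*-δ i (λ _ → d)))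

  if-cong : ∀ b {x y z : ℚ} → x ≡ y → (if b then x else z) ≡ (if b then y else z)
  if-cong b eq = cong (if b then_else _) eq

  lap≡sum : ∀ {N} (G : Graph N) x v → lap G x v ≡ sum (λ u → if G v u then x v - x u else 0ℚ)
  lap≡sum G x v = foldr-allFin +-0-isCommutativeMonoid (λ u → if G v u then x v - x u else 0ℚ)

  lap-cong : ∀ {N} (G : Graph N) {x y} → (∀ u → x u ≡ y u) → ∀ v → lap G x v ≡ lap G y v
  lap-cong G {x} {y} x≗y v = begin
    lap G x v                                        ≡⟨ lap≡sum G x v ⟩
    sum (λ u → if G v u then x v - x u else 0ℚ)      ≡⟨ sum-cong-≗ (λ u → if-cong (G v u) (cong₂ _-_ (x≗y v) (x≗y u))) ⟩
    sum (λ u → if G v u then y v - y u else 0ℚ)      ≡⟨ lap≡sum G y v ⟨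
    lap G y v                                        ∎

  lap-minus : ∀ {N} (G : Graph N) x y v → lap G (λ u → x u - y u) v ≡ lap G x v - lap G y v
  lap-minus G x y v = begin
    lap G (λ u → x u - y u) v                                         ≡⟨ lap≡sum G (λ u → x u - y u) v ⟩
    sum (λ u → if G v u then (x v - y v) - (x u - y u) else 0ℚ)       ≡⟨ sum-cong-≗ (λ u → pointwise (G v u) u) ⟩
    sum (λ u → (if G v u then x v - x u else 0ℚ) - (if G v u then y v - y u else 0ℚ))
      ≡⟨ sum-minus (λ u → if G v u then x v - x u else 0ℚ) (λ u → if G v u then y v - y u else 0ℚ) ⟩
    sum (λ u → if G v u then x v - x u else 0ℚ) - sum (λ u → if G v u then y v - y u else 0ℚ)
      ≡⟨ cong₂ _-_ (lap≡sum G x v) (lap≡sum G y v) ⟨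
    lap G x v - lap G y v                                             ∎
    where
    open +-*-Solver
    pointwise : ∀ b u → (if b then (x v - y v) - (x u - y u) else 0ℚ) ≡ (if b then x v - x u else 0ℚ) - (if b then y v - y u else 0ℚ)
    pointwise true  u = solve 4 (λ a b c d → (a :- b) :- (c :- d) := (a :- c) :- (b :- d)) refl (x v) (y v) (x u) (y u)
    pointwise false u = refl

  module _ {N : ℕ} (G : Graph N) (G-sym : ∀ u v → G u v ≡ G v u) where

    -- Split each edge term into a product at one vertex and a product across the edge. The first is
    -- symmetric in `x` and `y` pointwise; the second becomes so after exchanging the order of
    -- summation, by symmetry of the graph.
    lap-selfAdjoint : ∀ x y → sum (λ v → y v * lap G x v) ≡ sum (λ v → x v * lap G y v)
    lap-selfAdjoint x y = begin
      sum (λ v → y v * lap G x v)                                ≡⟨ sum-cong-≗ (expand x y) ⟩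
      sum (λ v → sum (diag x y v) - sum (cross x y v))           ≡⟨ sum-minus (λ v → sum (diag x y v)) (λ v → sum (cross x y v)) ⟩
      sum (λ v → sum (diag x y v)) - sum (λ v → sum (cross x y v))
        ≡⟨ cong₂ _-_ (sum-cong-≗ (λ v → sum-cong-≗ (λ u → if-cong (G v u) (*-comm (y v) (x v)))))
                     (trans (∑-comm (cross x y)) (sum-cong-≗ (λ v → sum-cong-≗ (λ u → cross-swap v u)))) ⟩
      sum (λ v → sum (diag y x v)) - sum (λ v → sum (cross y x v)) ≡⟨ sum-minus (λ v → sum (diag y x v)) (λ v → sum (cross y x v)) ⟨
      sum (λ v → sum (diag y x v) - sum (cross y x v))           ≡⟨ sum-cong-≗ (expand y x) ⟨
      sum (λ v → x v * lap G y v)                                ∎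
      where
      open +-*-Solver
      diag cross : (Fin N → ℚ) → (Fin N → ℚ) → Fin N → Fin N → ℚ
      diag  x y v u = if G v u then y v * x v else 0ℚ
      cross x y v u = if G v u then y v * x u else 0ℚ

      cross-swap : ∀ v u → cross x y u v ≡ cross y x v u
      cross-swap v u rewrite G-sym u v = if-cong (G v u) (*-comm (y u) (x v))

      expand : ∀ x y v → y v * lap G x v ≡ sum (diag x y v) - sum (cross x y v)
      expand x y v = begin
        y v * lap G x v                                          ≡⟨ cong (y v *_) (lap≡sum G x v) ⟩
        y v * sum (λ u → if G v u then x v - x u else 0ℚ)        ≡⟨ *-distribˡ-sum (y v) (λ u → if G v u then x v - x u else 0ℚ) ⟩
        sum (λ u → y v * (if G v u then x v - x u else 0ℚ))      ≡⟨ sum-cong-≗ (λ u → pointwise (G v u) u) ⟩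
        sum (λ u → diag x y v u - cross x y v u)                 ≡⟨ sum-minus (diag x y v) (cross x y v) ⟩
        sum (diag x y v) - sum (cross x y v)                     ∎
        where
        pointwise : ∀ b u → y v * (if b then x v - x u else 0ℚ) ≡ (if b then y v * x v else 0ℚ) - (if b then y v * x u else 0ℚ)
        pointwise true  u = solve 3 (λ a b c → a :* (b :- c) := a :* b :- a :* c) refl (y v) (x v) (x u)
        pointwise false u = *-zeroʳ (y v)

    -- Pairing with a unit current from `i` to `j` evaluates a function at its two ends. Since `y`
    -- is arbitrary, one potential can be tested against the current of another.
    potential-drop : ∀ i j x → (∀ v → lap G x v ≡ δ i v - δ j v) → ∀ y → sum (λ v → y v * lap G x v) ≡ y i - y j
    potential-drop i j x x-flow y = begin
      sum (λ v → y v * lap G x v)                           ≡⟨ sum-cong-≗ (λ v → trans (cong (y v *_) (x-flow v)) (distrib v)) ⟩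
      sum (λ v → y v * δ i v - y v * δ j v)                 ≡⟨ sum-minus (λ v → y v * δ i v) (λ v → y v * δ j v) ⟩
      sum (λ v → y v * δ i v) - sum (λ v → y v * δ j v)     ≡⟨ cong₂ _-_ (sum-*-δ i y) (sum-*-δ j y) ⟩
      y i - y j                                             ∎
      where
      open +-*-Solver
      distrib : ∀ v → y v * (δ i v - δ j v) ≡ y v * δ i v - y v * δ j v
      distrib v = solve 3 (λ a b c → a :* (b :- c) := a :* b :- a :* c) refl (y v) (δ i v) (δ j v)

    -- Pair each potential with the current of the other: one pairing yields the drop of `x`, the
    -- other that of `y`, and self-adjointness equates them.
    IsResistance-unique : ∀ {i j r s} → IsResistance G i j r → IsResistance G i j s → r ≡ s
    IsResistance-unique {i} {j} (x , x-flow , refl) (y , y-flow , refl) = begin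
      x i - x j                        ≡⟨ potential-drop i j y y-flow x ⟨
      sum (λ v → x v * lap G y v)      ≡⟨ lap-selfAdjoint y x ⟩
      sum (λ v → y v * lap G x v)      ≡⟨ potential-drop i j x x-flow y ⟩
      y i - y j                        ∎

    IsKirchhoffIndex-unique : ∀ {k l} → IsKirchhoffIndex G k → IsKirchhoffIndex G l → k ≡ l
    IsKirchhoffIndex-unique (r , r-res , refl) (s , s-res , refl) =
      cong sumℚ (map-cong (λ i → cong sumℚ (map-cong (λ j → if-cong (toℕ i ℕ.<ᵇ toℕ j) (IsResistance-unique (r-res i j) (s-res i j))) (allFin N))) (allFin N))

  -- In the other copy only the partner of `u` is adjacent, so that half of the sum collapses to a
  -- single rung term.
  lap-×K₂-lo : ∀ {n} (G : Graph n) x u → lap (G ×K₂) x (lo u) ≡ lap G (x ∘ lo) u + (x (lo u) - x (hi u))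
  lap-×K₂-lo {n} G x u = begin
    lap (G ×K₂) x (lo u)   ≡⟨ lap≡sum (G ×K₂) x (lo u) ⟩
    sum (λ v → if (G ×K₂) (lo u) v then x (lo u) - x v else 0ℚ)   ≡⟨ sum-+ +-0-isCommutativeMonoid n n _ ⟩
    sum (λ (v : Fin n) → if (G ×K₂) (lo u) (lo v) then x (lo u) - x (lo v) else 0ℚ) + sum (λ (v : Fin n) → if (G ×K₂) (lo u) (hi v) then x (lo u) - x (hi v) else 0ℚ)
      ≡⟨ cong₂ _+_ (sum-cong-≗ (λ v → cong (if_then x (lo u) - x (lo v) else 0ℚ) (×K₂-lo-lo G u v)))
                   (sum-cong-≗ (λ v → cong (if_then x (lo u) - x (hi v) else 0ℚ) (×K₂-lo-hi G u v))) ⟩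
    sum (λ v → if G u v then x (lo u) - x (lo v) else 0ℚ) + sum (λ v → if ⌊ u ≟ v ⌋ then x (lo u) - x (hi v) else 0ℚ)
      ≡⟨ cong₂ _+_ (sym (lap≡sum G (x ∘ lo) u)) (sum-δ +-0-isCommutativeMonoid u (λ v → x (lo u) - x (hi v))) ⟩
    lap G (x ∘ lo) u + (x (lo u) - x (hi u))  ∎

  lap-×K₂-hi : ∀ {n} (G : Graph n) x u → lap (G ×K₂) x (hi u) ≡ lap G (x ∘ hi) u + (x (hi u) - x (lo u))
  lap-×K₂-hi {n} G x u = begin
    lap (G ×K₂) x (hi u)   ≡⟨ lap≡sum (G ×K₂) x (hi u) ⟩
    sum (λ v → if (G ×K₂) (hi u) v then x (hi u) - x v else 0ℚ)   ≡⟨ sum-+ +-0-isCommutativeMonoid n n _ ⟩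
    sum (λ (v : Fin n) → if (G ×K₂) (hi u) (lo v) then x (hi u) - x (lo v) else 0ℚ) + sum (λ (v : Fin n) → if (G ×K₂) (hi u) (hi v) then x (hi u) - x (hi v) else 0ℚ)
      ≡⟨ cong₂ _+_ (sum-cong-≗ (λ v → cong (if_then x (hi u) - x (lo v) else 0ℚ) (×K₂-hi-lo G u v)))
                   (sum-cong-≗ (λ v → cong (if_then x (hi u) - x (hi v) else 0ℚ) (×K₂-hi-hi G u v))) ⟩
    sum (λ v → if ⌊ u ≟ v ⌋ then x (hi u) - x (lo v) else 0ℚ) + sum (λ v → if G u v then x (hi u) - x (hi v) else 0ℚ)
      ≡⟨ cong₂ _+_ (sum-δ +-0-isCommutativeMonoid u (λ v → x (hi u) - x (lo v))) (sym (lap≡sum G (x ∘ hi) u)) ⟩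
    (x (hi u) - x (lo u)) + lap G (x ∘ hi) u  ≡⟨ +-comm (x (hi u) - x (lo u)) _ ⟩
    lap G (x ∘ hi) u + (x (hi u) - x (lo u))  ∎

  lap-star-centre : ∀ {m} x → lap (star (suc m)) x zero ≡ sum (λ i → x zero - x (suc i))
  lap-star-centre {m} x = trans (lap≡sum (star (suc m)) x zero) (+-identityˡ _)

  lap-star-leaf : ∀ {m} x i → lap (star (suc m)) x (suc i) ≡ x (suc i) - x zero
  lap-star-leaf {m} x i = begin
    lap (star (suc m)) x (suc i)                 ≡⟨ lap≡sum (star (suc m)) x (suc i) ⟩
    x (suc i) - x zero + sum {m} (λ _ → 0ℚ)      ≡⟨ cong (x (suc i) - x zero +_) (trans (sum-const m 0ℚ) (*-zeroʳ (fromℕ m))) ⟩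
    x (suc i) - x zero + 0ℚ                      ≡⟨ +-identityʳ _ ⟩
    x (suc i) - x zero                           ∎

-- The Kirchhoff index from an explicit Green's function

module KirchhoffIndex where
  open import Data.Fin using (Fin; zero; suc; splitAt)
  open import Data.Fin.Properties using (splitAt-↑ˡ; splitAt-↑ʳ; ↑ˡ-injective; ↑ʳ-injective; suc-injective)
  open import Data.Integer as ℤ using (ℤ; +_)
  open import Data.Bool using (if_then_else_)
  open import Data.Nat as ℕ using (ℕ; suc)
  open import Data.Product using (_,_)
  open import Data.Rational using (ℚ; 0ℚ; 1ℚ; ½; _+_; _*_; _-_; -_; _/_)
  open import Data.Rational.Properties using (*-identityʳ; +-identityˡ; +-comm; +-0-isCommutativeMonoid)
  open import Data.Rational.Solver using (module +-*-Solver)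
  open import Data.Sum using (_⊎_; inj₁; inj₂; [_,_]′)
  open import Function using (_∘_)
  open import Relation.Binary.PropositionalEquality
  open Rationals
  open Laplacian
  open FiniteSums
  open TwoCopies
  open +-*-Solver
  open ≡-Reasoning

  module _ {n : ℕ} (i j : Fin n) where
    δ-lo-lo : δ (lo i) (lo j) ≡ δ i j
    δ-lo-lo = cong (if_then 1ℚ else 0ℚ) (⌊≟⌋-injective lo (↑ˡ-injective n _ _) i j)

    δ-hi-hi : δ (hi i) (hi j) ≡ δ i j
    δ-hi-hi = cong (if_then 1ℚ else 0ℚ) (⌊≟⌋-injective hi (↑ʳ-injective n _ _) i j)

    δ-lo-hi : δ (lo i) (hi j) ≡ 0ℚ
    δ-lo-hi = cong (if_then 1ℚ else 0ℚ) (⌊≟⌋-≢ lo≢hi)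

    δ-hi-lo : δ (hi i) (lo j) ≡ 0ℚ
    δ-hi-lo = cong (if_then 1ℚ else 0ℚ) (⌊≟⌋-≢ (λ eq → lo≢hi (sym eq)))

  ⅓ ⅔ : ℚ
  ⅓ = + 1 / 3
  ⅔ = + 2 / 3

  module _ {N : ℕ} (G : Graph N) (g : Fin N → Fin N → ℚ) (h : Fin N → ℚ)
           (lap-g : ∀ i v → lap G (g i) v ≡ δ i v - h v) where

    resistance : Fin N → Fin N → ℚ
    resistance i j = (g i i - g j i) - (g i j - g j j)

    resistance-isResistance : ∀ i j → IsResistance G i j (resistance i j)
    resistance-isResistance i j = (λ v → g i v - g j v) , flow , refl
      where
      flow : ∀ v → lap G (λ u → g i u - g j u) v ≡ δ i v - δ j v
      flow v = begin
        lap G (λ u → g i u - g j u) v        ≡⟨ lap-minus G (g i) (g j) v ⟩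
        lap G (g i) v - lap G (g j) v        ≡⟨ cong₂ _-_ (lap-g i v) (lap-g j v) ⟩
        (δ i v - h v) - (δ j v - h v)        ≡⟨ solve 3 (λ a b c → (a :- c) :- (b :- c) := a :- b) refl (δ i v) (δ j v) (h v) ⟩
        δ i v - δ j v                        ∎

    trace total : ℚ
    trace = sum (λ i → g i i)
    total = sum (λ i → sum (g i))

    -- Each diagonal term is constant in one of the two indices and contributes N times the trace;
    -- each mixed term contributes the full sum.
    sum-resistance : sum (λ i → sum (resistance i)) ≡ (fromℕ N * trace - total) + (fromℕ N * trace - total)
    sum-resistance = begin
      sum (λ i → sum (resistance i))
        ≡⟨ sum-cong-≗ (λ i → trans (sum-minus (λ j → g i i - g j i) (λ j → g i j - g j j))
                                   (cong₂ _-_ (trans (sum-minus (λ _ → g i i) (λ j → g j i)) (cong (_- sum (λ j → g j i)) (sum-const N (g i i))))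
                                              (sum-minus (g i) (λ j → g j j)))) ⟩
      sum (λ i → (fromℕ N * g i i - sum (λ j → g j i)) - (sum (g i) - trace))
        ≡⟨ trans (sum-minus (λ i → fromℕ N * g i i - sum (λ j → g j i)) (λ i → sum (g i) - trace))
                 (cong₂ _-_ (sum-minus (λ i → fromℕ N * g i i) (λ i → sum (λ j → g j i)))
                            (trans (sum-minus (λ i → sum (g i)) (λ _ → trace)) (cong (_-_ total) (sum-const N trace)))) ⟩
      (sum (λ i → fromℕ N * g i i) - sum (λ i → sum (λ j → g j i))) - (total - fromℕ N * trace)
        ≡⟨ cong (λ x → x - (total - fromℕ N * trace)) (cong₂ _-_ (sym (*-distribˡ-sum (fromℕ N) (λ i → g i i))) (sym (∑-comm g))) ⟩
      (fromℕ N * trace - total) - (total - fromℕ N * trace)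
        ≡⟨ solve 2 (λ a b → (a :- b) :- (b :- a) := (a :- b) :+ (a :- b)) refl (fromℕ N * trace) total ⟩
      (fromℕ N * trace - total) + (fromℕ N * trace - total) ∎

    isKirchhoffIndex : IsKirchhoffIndex G (fromℕ N * trace - total)
    -- `sum-pairs` yields only the doubled index, so the equality is proved after multiplication by
    -- 2.
    isKirchhoffIndex = resistance , resistance-isResistance , *-cancelʳ-fromℕ 1 (begin
      k * fromℕ 2          ≡⟨ double k ⟨
      k + k                ≡⟨ sum-resistance ⟨
      sum (λ i → sum (resistance i))  ≡⟨ sum-pairs +-0-isCommutativeMonoid resistance
           (λ i j → solve 4 (λ a b c d → (a :- b) :- (c :- d) := (d :- c) :- (b :- a)) refl (g i i) (g j i) (g i j) (g j j))
           (λ i → solve 1 (λ a → (a :- a) :- (a :- a) := con 0ℚ) refl (g i i)) ⟨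
      sumPairsℚ resistance + sumPairsℚ resistance   ≡⟨ double (sumPairsℚ resistance) ⟩
      sumPairsℚ resistance * fromℕ 2 ∎)
      where
      k = fromℕ N * trace - total
      double : ∀ x → x + x ≡ x * fromℕ 2
      double x = solve 1 (λ x → x :+ x := x :* con (fromℕ 2)) refl x

  -- On functions (anti)symmetric under swapping the copies, L acts as L_star (resp. L_star + 2).
  -- Inverting both, with t = 1 / (12 (m + 3)) and weights w = 3 at the centre, 1 at the leaves,
  -- gives t w_i w_j + ⅔ δ_ij within a copy and ⅓ δ_ij − t w_i w_j across, δ restricted to leaves.
  module _ {m : ℕ} (t : ℚ) where
    same other : Fin (suc m) → Fin (suc m) → ℚ
    same zero    zero    = fromℕ 9 * t
    same zero    (suc j) = fromℕ 3 * t
    same (suc i) zero    = fromℕ 3 * t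
    same (suc i) (suc j) = t + ⅔ * δ i j
    other zero    zero    = - (fromℕ 9 * t)
    other zero    (suc j) = - (fromℕ 3 * t)
    other (suc i) zero    = - (fromℕ 3 * t)
    other (suc i) (suc j) = - t + ⅓ * δ i j

    green′ : Fin (suc m) ⊎ Fin (suc m) → Fin (suc m) ⊎ Fin (suc m) → ℚ
    green′ (inj₁ i) (inj₁ j) = same i j
    green′ (inj₁ i) (inj₂ j) = other i j
    green′ (inj₂ i) (inj₁ j) = other i j
    green′ (inj₂ i) (inj₂ j) = same i j

    green : Fin (suc m ℕ.+ suc m) → Fin (suc m ℕ.+ suc m) → ℚ
    green u v = green′ (splitAt (suc m) u) (splitAt (suc m) v)

    green-lo-lo : ∀ i j → green (lo i) (lo j) ≡ same i j
    green-lo-lo i j = cong₂ green′ (splitAt-↑ˡ (suc m) i (suc m)) (splitAt-↑ˡ (suc m) j (suc m))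
    green-lo-hi : ∀ i j → green (lo i) (hi j) ≡ other i j
    green-lo-hi i j = cong₂ green′ (splitAt-↑ˡ (suc m) i (suc m)) (splitAt-↑ʳ (suc m) (suc m) j)
    green-hi-lo : ∀ i j → green (hi i) (lo j) ≡ other i j
    green-hi-lo i j = cong₂ green′ (splitAt-↑ʳ (suc m) (suc m) i) (splitAt-↑ˡ (suc m) j (suc m))
    green-hi-hi : ∀ i j → green (hi i) (hi j) ≡ same i j
    green-hi-hi i j = cong₂ green′ (splitAt-↑ʳ (suc m) (suc m) i) (splitAt-↑ʳ (suc m) (suc m) j)

    -- The injected unit is withdrawn in equal parts at the two centres. This choice is symmetric
    -- under swapping the copies, so it enters only the inversion on symmetric functions.
    ground : Fin (suc m) → ℚ
    ground zero    = ½
    ground (suc _) = 0ℚ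

    module _ (t-def : t * (fromℕ 36 + fromℕ 12 * fromℕ m) ≡ 1ℚ) where
      private
        q : ℚ
        q = fromℕ m

      lap-same : ∀ i j → lap (star (suc m)) (same i) j + (same i j - other i j) ≡ δ i j - ground j
      lap-same zero zero = begin
        lap (star (suc m)) (same zero) zero + (fromℕ 9 * t - - (fromℕ 9 * t))
          ≡⟨ cong (_+ (fromℕ 9 * t - - (fromℕ 9 * t))) (trans (lap-star-centre (same zero)) (sum-const m (fromℕ 9 * t - fromℕ 3 * t))) ⟩
        q * (fromℕ 9 * t - fromℕ 3 * t) + (fromℕ 9 * t - - (fromℕ 9 * t))
          -- The right side is arranged so that `t` occurs only in the product that `t-def`
          -- evaluates; the other cases at a centre do the same.
          ≡⟨ solve 2 (λ q t → q :* (con (fromℕ 9) :* t :- con (fromℕ 3) :* t) :+ (con (fromℕ 9) :* t :- :- (con (fromℕ 9) :* t)) := con ½ :* (t :* (con (fromℕ 36) :+ con (fromℕ 12) :* q))) refl q t ⟩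
        ½ * (t * (fromℕ 36 + fromℕ 12 * q))       ≡⟨ cong (½ *_) t-def ⟩
        ½ * 1ℚ                                    ∎
      lap-same zero (suc j) = begin
        lap (star (suc m)) (same zero) (suc j) + (fromℕ 3 * t - - (fromℕ 3 * t))
          ≡⟨ cong (_+ (fromℕ 3 * t - - (fromℕ 3 * t))) (lap-star-leaf (same zero) j) ⟩
        (fromℕ 3 * t - fromℕ 9 * t) + (fromℕ 3 * t - - (fromℕ 3 * t))
          ≡⟨ solve 1 (λ t → (con (fromℕ 3) :* t :- con (fromℕ 9) :* t) :+ (con (fromℕ 3) :* t :- :- (con (fromℕ 3) :* t)) := con 0ℚ) refl t ⟩
        0ℚ ∎
      lap-same (suc i) zero = begin
        lap (star (suc m)) (same (suc i)) zero + (fromℕ 3 * t - - (fromℕ 3 * t))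
          ≡⟨ cong (_+ (fromℕ 3 * t - - (fromℕ 3 * t))) (trans (lap-star-centre (same (suc i)))
                (trans (sum-minus (λ _ → fromℕ 3 * t) (λ j → t + ⅔ * δ i j)) (cong₂ _-_ (sum-const m (fromℕ 3 * t)) (sum-affine-δ i t ⅔)))) ⟩
        (q * (fromℕ 3 * t) - (q * t + ⅔)) + (fromℕ 3 * t - - (fromℕ 3 * t))
          ≡⟨ solve 2 (λ q t → (q :* (con (fromℕ 3) :* t) :- (q :* t :+ con ⅔)) :+ (con (fromℕ 3) :* t :- :- (con (fromℕ 3) :* t)) := con (+ 1 / 6) :* (t :* (con (fromℕ 36) :+ con (fromℕ 12) :* q)) :- con ⅔) refl q t ⟩
        (+ 1 / 6) * (t * (fromℕ 36 + fromℕ 12 * q)) - ⅔       ≡⟨ cong (λ x → (+ 1 / 6) * x - ⅔) t-def ⟩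
        -- Only closed rationals remain, and both sides evaluate to -½.
        (+ 1 / 6) * 1ℚ - ⅔                                    ∎
      lap-same (suc i) (suc j) = begin
        lap (star (suc m)) (same (suc i)) (suc j) + ((t + ⅔ * δ i j) - (- t + ⅓ * δ i j))
          ≡⟨ cong (_+ ((t + ⅔ * δ i j) - (- t + ⅓ * δ i j))) (lap-star-leaf (same (suc i)) j) ⟩
        ((t + ⅔ * δ i j) - fromℕ 3 * t) + ((t + ⅔ * δ i j) - (- t + ⅓ * δ i j))
          ≡⟨ solve 2 (λ t d → ((t :+ con ⅔ :* d) :- con (fromℕ 3) :* t) :+ ((t :+ con ⅔ :* d) :- (:- t :+ con ⅓ :* d)) := d :- con 0ℚ) refl t (δ i j) ⟩
        δ i j - 0ℚ            ≡⟨ cong (_- 0ℚ) (δ-suc i j) ⟨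
        δ (suc i) (suc j) - 0ℚ ∎
        where
        δ-suc : ∀ i j → δ (suc i) (suc j) ≡ δ i j
        δ-suc i j = cong (if_then 1ℚ else 0ℚ) (⌊≟⌋-injective suc suc-injective i j)

      lap-other : ∀ i j → lap (star (suc m)) (other i) j + (other i j - same i j) ≡ - ground j
      lap-other zero zero = begin
        lap (star (suc m)) (other zero) zero + (- (fromℕ 9 * t) - fromℕ 9 * t)
          ≡⟨ cong (_+ (- (fromℕ 9 * t) - fromℕ 9 * t)) (trans (lap-star-centre (other zero)) (sum-const m (- (fromℕ 9 * t) - - (fromℕ 3 * t)))) ⟩
        q * (- (fromℕ 9 * t) - - (fromℕ 3 * t)) + (- (fromℕ 9 * t) - fromℕ 9 * t)
          ≡⟨ solve 2 (λ q t → q :* (:- (con (fromℕ 9) :* t) :- :- (con (fromℕ 3) :* t)) :+ (:- (con (fromℕ 9) :* t) :- con (fromℕ 9) :* t) := :- (con ½ :* (t :* (con (fromℕ 36) :+ con (fromℕ 12) :* q)))) refl q t ⟩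
        - (½ * (t * (fromℕ 36 + fromℕ 12 * q)))       ≡⟨ cong (λ x → - (½ * x)) t-def ⟩
        - (½ * 1ℚ)                                    ∎
      lap-other zero (suc j) = begin
        lap (star (suc m)) (other zero) (suc j) + (- (fromℕ 3 * t) - fromℕ 3 * t)
          ≡⟨ cong (_+ (- (fromℕ 3 * t) - fromℕ 3 * t)) (lap-star-leaf (other zero) j) ⟩
        (- (fromℕ 3 * t) - - (fromℕ 9 * t)) + (- (fromℕ 3 * t) - fromℕ 3 * t)
          ≡⟨ solve 1 (λ t → (:- (con (fromℕ 3) :* t) :- :- (con (fromℕ 9) :* t)) :+ (:- (con (fromℕ 3) :* t) :- con (fromℕ 3) :* t) := con 0ℚ) refl t ⟩
        0ℚ ∎
      lap-other (suc i) zero = begin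
        lap (star (suc m)) (other (suc i)) zero + (- (fromℕ 3 * t) - fromℕ 3 * t)
          ≡⟨ cong (_+ (- (fromℕ 3 * t) - fromℕ 3 * t)) (trans (lap-star-centre (other (suc i)))
                (trans (sum-minus (λ _ → - (fromℕ 3 * t)) (λ j → - t + ⅓ * δ i j)) (cong₂ _-_ (sum-const m (- (fromℕ 3 * t))) (sum-affine-δ i (- t) ⅓)))) ⟩
        (q * - (fromℕ 3 * t) - (q * - t + ⅓)) + (- (fromℕ 3 * t) - fromℕ 3 * t)
          ≡⟨ solve 2 (λ q t → (q :* :- (con (fromℕ 3) :* t) :- (q :* :- t :+ con ⅓)) :+ (:- (con (fromℕ 3) :* t) :- con (fromℕ 3) :* t) := :- (con (+ 1 / 6) :* (t :* (con (fromℕ 36) :+ con (fromℕ 12) :* q))) :- con ⅓) refl q t ⟩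
        - ((+ 1 / 6) * (t * (fromℕ 36 + fromℕ 12 * q))) - ⅓       ≡⟨ cong (λ x → - ((+ 1 / 6) * x) - ⅓) t-def ⟩
        - ((+ 1 / 6) * 1ℚ) - ⅓                                    ∎
      lap-other (suc i) (suc j) = begin
        lap (star (suc m)) (other (suc i)) (suc j) + ((- t + ⅓ * δ i j) - (t + ⅔ * δ i j))
          ≡⟨ cong (_+ ((- t + ⅓ * δ i j) - (t + ⅔ * δ i j))) (lap-star-leaf (other (suc i)) j) ⟩
        ((- t + ⅓ * δ i j) - - (fromℕ 3 * t)) + ((- t + ⅓ * δ i j) - (t + ⅔ * δ i j))
          ≡⟨ solve 2 (λ t d → ((:- t :+ con ⅓ :* d) :- :- (con (fromℕ 3) :* t)) :+ ((:- t :+ con ⅓ :* d) :- (t :+ con ⅔ :* d)) := con 0ℚ) refl t (δ i j) ⟩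
        0ℚ ∎

      ground² : Fin (suc m ℕ.+ suc m) → ℚ
      ground² v = [ ground , ground ]′ (splitAt (suc m) v)

      -- On each copy the product Laplacian is the star Laplacian plus one rung difference, which is
      -- the left side of `lap-same` or of `lap-other` according to whether source and target share
      -- a copy.
      lap-green : ∀ u v → lap (S² (suc m)) (green u) v ≡ δ u v - ground² v
      lap-green u v with copy (suc m) u | copy (suc m) v
      ... | isLo i | isLo j = begin
        lap (S² (suc m)) (green (lo i)) (lo j)                                       ≡⟨ lap-×K₂-lo (star (suc m)) (green (lo i)) j ⟩
        lap (star (suc m)) (green (lo i) ∘ lo) j + (green (lo i) (lo j) - green (lo i) (hi j))
          ≡⟨ cong₂ _+_ (lap-cong (star (suc m)) (green-lo-lo i) j) (cong₂ _-_ (green-lo-lo i j) (green-lo-hi i j)) ⟩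
        lap (star (suc m)) (same i) j + (same i j - other i j)                       ≡⟨ lap-same i j ⟩
        δ i j - ground j                                                             ≡⟨ cong₂ _-_ (δ-lo-lo i j) (cong [ ground , ground ]′ (splitAt-↑ˡ (suc m) j (suc m))) ⟨
        δ (lo i) (lo j) - ground² (lo j)                                             ∎
      ... | isLo i | isHi j = begin
        lap (S² (suc m)) (green (lo i)) (hi j)                                       ≡⟨ lap-×K₂-hi (star (suc m)) (green (lo i)) j ⟩
        lap (star (suc m)) (green (lo i) ∘ hi) j + (green (lo i) (hi j) - green (lo i) (lo j))
          ≡⟨ cong₂ _+_ (lap-cong (star (suc m)) (green-lo-hi i) j) (cong₂ _-_ (green-lo-hi i j) (green-lo-lo i j)) ⟩
        lap (star (suc m)) (other i) j + (other i j - same i j)                      ≡⟨ lap-other i j ⟩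
        - ground j                                                                   ≡⟨ +-identityˡ (- ground j) ⟨
        0ℚ - ground j                                                                ≡⟨ cong₂ _-_ (δ-lo-hi i j) (cong [ ground , ground ]′ (splitAt-↑ʳ (suc m) (suc m) j)) ⟨
        δ (lo i) (hi j) - ground² (hi j)                                             ∎
      ... | isHi i | isLo j = begin
        lap (S² (suc m)) (green (hi i)) (lo j)                                       ≡⟨ lap-×K₂-lo (star (suc m)) (green (hi i)) j ⟩
        lap (star (suc m)) (green (hi i) ∘ lo) j + (green (hi i) (lo j) - green (hi i) (hi j))
          ≡⟨ cong₂ _+_ (lap-cong (star (suc m)) (green-hi-lo i) j) (cong₂ _-_ (green-hi-lo i j) (green-hi-hi i j)) ⟩
        lap (star (suc m)) (other i) j + (other i j - same i j)                      ≡⟨ lap-other i j ⟩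
        - ground j                                                                   ≡⟨ +-identityˡ (- ground j) ⟨
        0ℚ - ground j                                                                ≡⟨ cong₂ _-_ (δ-hi-lo i j) (cong [ ground , ground ]′ (splitAt-↑ˡ (suc m) j (suc m))) ⟨
        δ (hi i) (lo j) - ground² (lo j)                                             ∎
      ... | isHi i | isHi j = begin
        lap (S² (suc m)) (green (hi i)) (hi j)                                       ≡⟨ lap-×K₂-hi (star (suc m)) (green (hi i)) j ⟩
        lap (star (suc m)) (green (hi i) ∘ hi) j + (green (hi i) (hi j) - green (hi i) (lo j))
          ≡⟨ cong₂ _+_ (lap-cong (star (suc m)) (green-hi-hi i) j) (cong₂ _-_ (green-hi-hi i j) (green-hi-lo i j)) ⟩
        lap (star (suc m)) (same i) j + (same i j - other i j)                       ≡⟨ lap-same i j ⟩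
        δ i j - ground j                                                             ≡⟨ cong₂ _-_ (δ-hi-hi i j) (cong [ ground , ground ]′ (splitAt-↑ʳ (suc m) (suc m) j)) ⟨
        δ (hi i) (hi j) - ground² (hi j)                                             ∎

    sum-same-diagonal : sum (λ i → same i i) ≡ fromℕ 9 * t + fromℕ m * (t + ⅔)
    sum-same-diagonal = cong (_+_ (fromℕ 9 * t)) (trans (sum-cong-≗ diagonal) (sum-const m (t + ⅔)))
      where
      diagonal : ∀ (i : Fin m) → t + ⅔ * δ i i ≡ t + ⅔
      diagonal i = cong (_+_ t) (trans (cong (λ b → ⅔ * (if b then 1ℚ else 0ℚ)) (⌊≟⌋-refl i)) (*-identityʳ ⅔))

    trace-green : sum (λ u → green u u) ≡ fromℕ 2 * (fromℕ 9 * t + fromℕ m * (t + ⅔))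
    trace-green = begin
      sum (λ u → green u u)     ≡⟨ sum-+ +-0-isCommutativeMonoid (suc m) (suc m) (λ u → green u u) ⟩
      sum (λ (i : Fin (suc m)) → green (lo i) (lo i)) + sum (λ (i : Fin (suc m)) → green (hi i) (hi i))
        ≡⟨ cong₂ _+_ (trans (sum-cong-≗ (λ i → green-lo-lo i i)) sum-same-diagonal) (trans (sum-cong-≗ (λ i → green-hi-hi i i)) sum-same-diagonal) ⟩
      s + s                     ≡⟨ solve 1 (λ s → s :+ s := con (fromℕ 2) :* s) refl s ⟩
      fromℕ 2 * s               ∎
      where s = fromℕ 9 * t + fromℕ m * (t + ⅔)

    -- Within a row the `t`-terms of the two copies cancel, which leaves ⅔ + ⅓ = 1 for a leaf and 0
    -- for a centre.
    sum-same+other : sum (λ i → sum (same i) + sum (other i)) ≡ fromℕ m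
    sum-same+other = begin
      sum (λ i → sum (same i) + sum (other i))                        ≡⟨ cong₂ _+_ centre (sum-cong-≗ leaf) ⟩
      0ℚ + sum {m} (λ _ → 1ℚ)                                         ≡⟨ +-identityˡ _ ⟩
      sum {m} (λ _ → 1ℚ)                                              ≡⟨ trans (sum-const m 1ℚ) (*-identityʳ _) ⟩
      fromℕ m                                                         ∎
      where
      centre : sum (same zero) + sum (other zero) ≡ 0ℚ
      centre = trans (cong₂ (λ x y → (fromℕ 9 * t + x) + (- (fromℕ 9 * t) + y)) (sum-const m (fromℕ 3 * t)) (sum-const m (- (fromℕ 3 * t))))
        (solve 2 (λ q t → (con (fromℕ 9) :* t :+ q :* (con (fromℕ 3) :* t)) :+ (:- (con (fromℕ 9) :* t) :+ q :* :- (con (fromℕ 3) :* t)) := con 0ℚ) refl (fromℕ m) t)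
      leaf : ∀ i → sum (same (suc i)) + sum (other (suc i)) ≡ 1ℚ
      leaf i = trans (cong₂ (λ x y → (fromℕ 3 * t + x) + (- (fromℕ 3 * t) + y)) (sum-affine-δ i t ⅔) (sum-affine-δ i (- t) ⅓))
        (solve 2 (λ q t → (con (fromℕ 3) :* t :+ (q :* t :+ con ⅔)) :+ (:- (con (fromℕ 3) :* t) :+ (q :* :- t :+ con ⅓)) := con 1ℚ) refl (fromℕ m) t)

    total-green : sum (λ u → sum (green u)) ≡ fromℕ 2 * fromℕ m
    total-green = begin
      sum (λ u → sum (green u))                                       ≡⟨ sum-+ +-0-isCommutativeMonoid (suc m) (suc m) (λ u → sum (green u)) ⟩
      sum (λ (i : Fin (suc m)) → sum (green (lo i))) + sum (λ (i : Fin (suc m)) → sum (green (hi i))) ≡⟨ cong₂ _+_ (trans (sum-cong-≗ row-lo) sum-same+other) (trans (sum-cong-≗ row-hi) sum-same+other) ⟩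
      fromℕ m + fromℕ m                                               ≡⟨ solve 1 (λ s → s :+ s := con (fromℕ 2) :* s) refl (fromℕ m) ⟩
      fromℕ 2 * fromℕ m                                               ∎
      where
      row-lo : ∀ i → sum (green (lo i)) ≡ sum (same i) + sum (other i)
      row-lo i = trans (sum-+ +-0-isCommutativeMonoid (suc m) (suc m) (green (lo i))) (cong₂ _+_ (sum-cong-≗ (green-lo-lo i)) (sum-cong-≗ (green-lo-hi i)))
      row-hi : ∀ i → sum (green (hi i)) ≡ sum (same i) + sum (other i)
      row-hi i = trans (sum-+ +-0-isCommutativeMonoid (suc m) (suc m) (green (hi i)))
        (trans (cong₂ _+_ (sum-cong-≗ (green-hi-lo i)) (sum-cong-≗ (green-hi-hi i))) (+-comm (sum (other i)) (sum (same i))))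

  kirchhoffNumerator : ℕ → ℤ
  kirchhoffNumerator n = + (8 ℕ.* n ℕ.^ 3 ℕ.+ 3 ℕ.* n ℕ.^ 2 ℕ.+ 12) ℤ.- + (14 ℕ.* n)

  -- With `6` as the first summand the denominator reduces to a successor and is visibly nonzero.
  kirchhoffIndex : ℕ → ℚ
  kirchhoffIndex n = kirchhoffNumerator n / (6 ℕ.+ 3 ℕ.* n)

  S²-isKirchhoffIndex : ∀ m → IsKirchhoffIndex (S² (suc m)) (kirchhoffIndex (suc m))
  S²-isKirchhoffIndex m = subst (IsKirchhoffIndex (S² n)) k≡ (isKirchhoffIndex (S² n) g (ground² {m} t t-def) (lap-green {m} t t-def))
    where
    n = suc m
    q = fromℕ m
    x = fromℕ n
    t : ℚ
    t = + 1 / (36 ℕ.+ 12 ℕ.* m)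

    t-def : t * (fromℕ 36 + fromℕ 12 * q) ≡ 1ℚ
    t-def = trans (cong (t *_) (sym (trans (fromℕ-+ 36 (12 ℕ.* m)) (cong (_+_ (fromℕ 36)) (fromℕ-* 12 m))))) (/-*-cancel (+ 1) (35 ℕ.+ 12 ℕ.* m))

    g : Fin (n ℕ.+ n) → Fin (n ℕ.+ n) → ℚ
    g = green {m} t

    numerator : fromℤ (kirchhoffNumerator n)
              ≡ fromℕ 8 * (x * (x * (x * 1ℚ))) + fromℕ 3 * (x * (x * 1ℚ)) + fromℕ 12 - fromℕ 14 * x
    numerator = begin
      fromℤ (kirchhoffNumerator n)
        ≡⟨ trans (fromℤ-+ (+ (8 ℕ.* n ℕ.^ 3 ℕ.+ 3 ℕ.* n ℕ.^ 2 ℕ.+ 12)) (ℤ.- + (14 ℕ.* n))) (cong (_+_ (fromℕ (8 ℕ.* n ℕ.^ 3 ℕ.+ 3 ℕ.* n ℕ.^ 2 ℕ.+ 12))) (fromℤ-neg (+ (14 ℕ.* n)))) ⟩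
      fromℕ (8 ℕ.* n ℕ.^ 3 ℕ.+ 3 ℕ.* n ℕ.^ 2 ℕ.+ 12) - fromℕ (14 ℕ.* n)
        ≡⟨ cong₂ _-_ (trans (fromℕ-+ (8 ℕ.* n ℕ.^ 3 ℕ.+ 3 ℕ.* n ℕ.^ 2) 12) (cong (_+ fromℕ 12)
             (trans (fromℕ-+ (8 ℕ.* n ℕ.^ 3) (3 ℕ.* n ℕ.^ 2))
               (cong₂ _+_ (trans (fromℕ-* 8 (n ℕ.^ 3)) (cong (fromℕ 8 *_) (fromℕ-^ 3)))
                          (trans (fromℕ-* 3 (n ℕ.^ 2)) (cong (fromℕ 3 *_) (fromℕ-^ 2)))))))
             (fromℕ-* 14 n) ⟩
      fromℕ 8 * (x * (x * (x * 1ℚ))) + fromℕ 3 * (x * (x * 1ℚ)) + fromℕ 12 - fromℕ 14 * x ∎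
      where
      pow : ℕ → ℚ
      pow 0       = 1ℚ
      pow (suc e) = x * pow e
      fromℕ-^ : ∀ e → fromℕ (n ℕ.^ e) ≡ pow e
      fromℕ-^ 0       = refl
      fromℕ-^ (suc e) = trans (fromℕ-* n (n ℕ.^ e)) (cong (x *_) (fromℕ-^ e))

    x≡ : x ≡ 1ℚ + q
    x≡ = fromℕ-+ 1 m

    k≡ : fromℕ (n ℕ.+ n) * sum (λ u → g u u) - sum (λ u → sum (g u)) ≡ kirchhoffIndex n
    k≡ = ≡-/ (kirchhoffNumerator n) (5 ℕ.+ 3 ℕ.* n) (begin
      (fromℕ (n ℕ.+ n) * sum (λ u → g u u) - sum (λ u → sum (g u))) * fromℕ (6 ℕ.+ 3 ℕ.* n)
        ≡⟨ cong₂ _*_ (cong₂ _-_ (cong₂ _*_ (trans (fromℕ-+ n n) (cong₂ _+_ x≡ x≡)) (trace-green {m} t)) (total-green {m} t))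
                     (trans (fromℕ-+ 6 (3 ℕ.* n)) (cong (_+_ (fromℕ 6)) (trans (fromℕ-* 3 n) (cong (fromℕ 3 *_) x≡)))) ⟩
      (((1ℚ + q) + (1ℚ + q)) * (fromℕ 2 * (fromℕ 9 * t + q * (t + ⅔))) - fromℕ 2 * q) * (fromℕ 6 + fromℕ 3 * (1ℚ + q))
        -- The doubled order and the doubled trace give a factor 4, and 4 (9 + 3q) = 36 + 12q, so
        -- the cleared denominator is what turns every `t` into the product of `t-def`.
        ≡⟨ solve 2 (λ q t → (((con 1ℚ :+ q) :+ (con 1ℚ :+ q)) :* (con (fromℕ 2) :* (con (fromℕ 9) :* t :+ q :* (t :+ con ⅔))) :- con (fromℕ 2) :* q) :* (con (fromℕ 6) :+ con (fromℕ 3) :* (con 1ℚ :+ q))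
             := (con 1ℚ :+ q) :* (con (fromℕ 9) :+ q) :* (t :* (con (fromℕ 36) :+ con (fromℕ 12) :* q))
                :+ (con (+ 8 / 3) :* (con 1ℚ :+ q) :* q :- con (fromℕ 2) :* q) :* (con (fromℕ 9) :+ con (fromℕ 3) :* q)) refl q t ⟩
      (1ℚ + q) * (fromℕ 9 + q) * (t * (fromℕ 36 + fromℕ 12 * q)) + ((+ 8 / 3) * (1ℚ + q) * q - fromℕ 2 * q) * (fromℕ 9 + fromℕ 3 * q)
        ≡⟨ cong (λ y → (1ℚ + q) * (fromℕ 9 + q) * y + ((+ 8 / 3) * (1ℚ + q) * q - fromℕ 2 * q) * (fromℕ 9 + fromℕ 3 * q)) t-def ⟩
      (1ℚ + q) * (fromℕ 9 + q) * 1ℚ + ((+ 8 / 3) * (1ℚ + q) * q - fromℕ 2 * q) * (fromℕ 9 + fromℕ 3 * q)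
        ≡⟨ solve 1 (λ q → (con 1ℚ :+ q) :* (con (fromℕ 9) :+ q) :* con 1ℚ :+ (con (+ 8 / 3) :* (con 1ℚ :+ q) :* q :- con (fromℕ 2) :* q) :* (con (fromℕ 9) :+ con (fromℕ 3) :* q)
             := con (fromℕ 8) :* ((con 1ℚ :+ q) :* ((con 1ℚ :+ q) :* ((con 1ℚ :+ q) :* con 1ℚ))) :+ con (fromℕ 3) :* ((con 1ℚ :+ q) :* ((con 1ℚ :+ q) :* con 1ℚ)) :+ con (fromℕ 12) :- con (fromℕ 14) :* (con 1ℚ :+ q)) refl q ⟩
      fromℕ 8 * ((1ℚ + q) * ((1ℚ + q) * ((1ℚ + q) * 1ℚ))) + fromℕ 3 * ((1ℚ + q) * ((1ℚ + q) * 1ℚ)) + fromℕ 12 - fromℕ 14 * (1ℚ + q)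
        ≡⟨ cong (λ x → fromℕ 8 * (x * (x * (x * 1ℚ))) + fromℕ 3 * (x * (x * 1ℚ)) + fromℕ 12 - fromℕ 14 * x) x≡ ⟨
      fromℕ 8 * (x * (x * (x * 1ℚ))) + fromℕ 3 * (x * (x * 1ℚ)) + fromℕ 12 - fromℕ 14 * x
        ≡⟨ numerator ⟨
      fromℤ (kirchhoffNumerator n) ∎)

-- Distances in the product and the Wiener index

module WienerIndex where
  open import Data.Bool using (true; false; if_then_else_)
  open import Data.Fin using (Fin; zero; suc; splitAt; toℕ)
  open import Data.Fin.Properties using (_≟_; splitAt-↑ˡ; splitAt-↑ʳ)
  open import Data.List using (allFin)
  open import Data.List.Properties using (map-cong)
  open import Data.Nat as ℕ using (ℕ; suc; _+_; _*_; _≤_; z≤n; s≤s)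
  open import Data.Nat.Properties using (+-0-commutativeMonoid; +-0-isCommutativeMonoid; <-cmp; <⇒≱; ≤-refl; ≤-trans; +-comm; *-cancelʳ-≡; *-identityʳ; m≤n+m; ≤-reflexive)
  open import Data.Nat.Tactic.RingSolver using (solve-∀)
  open import Data.Product using (_,_)
  open import Data.Sum using (_⊎_; inj₁; inj₂)
  open import Algebra.Properties.CommutativeMonoid.Sum +-0-commutativeMonoid using (sum; sum-cong-≗; ∑-distrib-+)
  open import Relation.Binary.Definitions using (tri<; tri≈; tri>)
  open import Relation.Binary.PropositionalEquality
  open import Relation.Nullary using (yes; no; contradiction)
  open import Relation.Nullary.Decidable using (⌊_⌋)
  open FiniteSums
  open TwoCopies
  open ≡-Reasoning

  module _ {N : ℕ} {G : Graph N} where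
    IsDistance-unique : ∀ {u v d e} → IsDistance G u v d → IsDistance G u v e → d ≡ e
    IsDistance-unique {d = d} {e} (p , p-min) (q , q-min) with <-cmp d e
    ... | tri< d<e _ _ = contradiction p (q-min d d<e)
    ... | tri≈ _ d≡e _ = d≡e
    ... | tri> _ _ e<d = contradiction q (p-min e e<d)

    IsWienerIndex-unique : ∀ {w x} → IsWienerIndex G w → IsWienerIndex G x → w ≡ x
    IsWienerIndex-unique (d , d-dist , refl) (e , e-dist , refl) =
      cong sumℕ (map-cong (λ i → cong sumℕ (map-cong (λ j → cong (if toℕ i ℕ.<ᵇ toℕ j then_else 0) (IsDistance-unique (d-dist i j) (e-dist i j))) (allFin N))) (allFin N))

    -- Such an `f` drops by at most one per edge, so reaching 0 takes at least `f u` steps. Taking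
    -- the candidate distance for `f` excludes shorter walks without classifying them.
    Lipschitz-≤-walk : (f : Fin N → ℕ) → (∀ u w → G u w ≡ true → f u ≤ suc (f w)) →
                       ∀ {u v k} → f v ≡ 0 → Walk G u v k → f u ≤ k
    Lipschitz-≤-walk f lip fv≡0 here = subst (_≤ 0) (sym fv≡0) z≤n
    Lipschitz-≤-walk f lip fv≡0 (step {u} {w} e p) = ≤-trans (lip u w e) (s≤s (Lipschitz-≤-walk f lip fv≡0 p))

  module _ {n : ℕ} {G : Graph n} where
    walk-lo : ∀ {u v k} → Walk G u v k → Walk (G ×K₂) (lo u) (lo v) k
    walk-lo here = here
    walk-lo (step {u} {w} e p) = step (trans (×K₂-lo-lo G u w) e) (walk-lo p)

    walk-hi : ∀ {u v k} → Walk G u v k → Walk (G ×K₂) (hi u) (hi v) k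
    walk-hi here = here
    walk-hi (step {u} {w} e p) = step (trans (×K₂-hi-hi G u w) e) (walk-hi p)

  module _ {m : ℕ} where
    starDist : Fin (suc m) → Fin (suc m) → ℕ
    starDist zero    zero    = 0
    starDist zero    (suc j) = 1
    starDist (suc i) zero    = 1
    starDist (suc i) (suc j) = if ⌊ i ≟ j ⌋ then 0 else 2

    starWalk : ∀ i j → Walk (star (suc m)) i j (starDist i j)
    starWalk zero    zero    = here
    starWalk zero    (suc j) = step refl here
    starWalk (suc i) zero    = step refl here
    starWalk (suc i) (suc j) with i ≟ j
    ... | yes refl = here
    ... | no  _    = step {w = zero} refl (step refl here)

    starDist-refl : ∀ i → starDist i i ≡ 0
    starDist-refl zero    = refl
    starDist-refl (suc i) = cong (if_then 0 else 2) (⌊≟⌋-refl i)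

    starDist-sym : ∀ i j → starDist i j ≡ starDist j i
    starDist-sym zero    zero    = refl
    starDist-sym zero    (suc j) = refl
    starDist-sym (suc i) zero    = refl
    starDist-sym (suc i) (suc j) = cong (if_then 0 else 2) (⌊≟⌋-sym i j)

    starDist-Lipschitz : ∀ i j k → star (suc m) i j ≡ true → starDist i k ≤ suc (starDist j k)
    starDist-Lipschitz zero    (suc j) zero    _ = z≤n
    starDist-Lipschitz zero    (suc j) (suc k) _ = s≤s z≤n
    starDist-Lipschitz (suc i) zero    zero    _ = s≤s z≤n
    starDist-Lipschitz (suc i) zero    (suc k) _ with i ≟ k
    ... | yes _ = z≤n
    ... | no  _ = ≤-refl

    dist′ : Fin (suc m) ⊎ Fin (suc m) → Fin (suc m) ⊎ Fin (suc m) → ℕ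
    dist′ (inj₁ i) (inj₁ j) = starDist i j
    dist′ (inj₁ i) (inj₂ j) = suc (starDist i j)
    dist′ (inj₂ i) (inj₁ j) = suc (starDist i j)
    dist′ (inj₂ i) (inj₂ j) = starDist i j

    dist : Fin (suc m + suc m) → Fin (suc m + suc m) → ℕ
    dist u v = dist′ (splitAt (suc m) u) (splitAt (suc m) v)

    dist-lo-lo : ∀ i j → dist (lo i) (lo j) ≡ starDist i j
    dist-lo-lo i j = cong₂ dist′ (splitAt-↑ˡ (suc m) i (suc m)) (splitAt-↑ˡ (suc m) j (suc m))
    dist-lo-hi : ∀ i j → dist (lo i) (hi j) ≡ suc (starDist i j)
    dist-lo-hi i j = cong₂ dist′ (splitAt-↑ˡ (suc m) i (suc m)) (splitAt-↑ʳ (suc m) (suc m) j)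
    dist-hi-lo : ∀ i j → dist (hi i) (lo j) ≡ suc (starDist i j)
    dist-hi-lo i j = cong₂ dist′ (splitAt-↑ʳ (suc m) (suc m) i) (splitAt-↑ˡ (suc m) j (suc m))
    dist-hi-hi : ∀ i j → dist (hi i) (hi j) ≡ starDist i j
    dist-hi-hi i j = cong₂ dist′ (splitAt-↑ʳ (suc m) (suc m) i) (splitAt-↑ʳ (suc m) (suc m) j)

    dist-walk : ∀ u v → Walk (S² (suc m)) u v (dist u v)
    dist-walk u v with copy (suc m) u | copy (suc m) v
    ... | isLo i | isLo j = subst (Walk _ _ _) (sym (dist-lo-lo i j)) (walk-lo (starWalk i j))
    ... | isLo i | isHi j = subst (Walk _ _ _) (sym (dist-lo-hi i j)) (step (trans (×K₂-lo-hi (star (suc m)) i i) (⌊≟⌋-refl i)) (walk-hi (starWalk i j)))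
    ... | isHi i | isLo j = subst (Walk _ _ _) (sym (dist-hi-lo i j)) (step (trans (×K₂-hi-lo (star (suc m)) i i) (⌊≟⌋-refl i)) (walk-lo (starWalk i j)))
    ... | isHi i | isHi j = subst (Walk _ _ _) (sym (dist-hi-hi i j)) (walk-hi (starWalk i j))

    dist-refl : ∀ u → dist u u ≡ 0
    dist-refl u with splitAt (suc m) u
    ... | inj₁ i = starDist-refl i
    ... | inj₂ i = starDist-refl i

    dist-sym : ∀ u v → dist u v ≡ dist v u
    dist-sym u v with splitAt (suc m) u | splitAt (suc m) v
    ... | inj₁ i | inj₁ j = starDist-sym i j
    ... | inj₁ i | inj₂ j = cong suc (starDist-sym i j)
    ... | inj₂ i | inj₁ j = cong suc (starDist-sym i j)
    ... | inj₂ i | inj₂ j = starDist-sym i j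

    starDist-congˡ : ∀ (i j k : Fin (suc m)) → ⌊ i ≟ j ⌋ ≡ true → starDist i k ≡ starDist j k
    starDist-congˡ i j k _ with i ≟ j
    ... | yes refl = refl

    -- `dist` is the star distance plus one if the copies differ. A star edge affects only the first
    -- summand, a rung only the second.
    dist-Lipschitz : ∀ w u v → S² (suc m) u v ≡ true → dist u w ≤ suc (dist v w)
    dist-Lipschitz w u v with splitAt (suc m) u | splitAt (suc m) v | splitAt (suc m) w
    ... | inj₁ i | inj₁ j | inj₁ k = starDist-Lipschitz i j k
    ... | inj₁ i | inj₁ j | inj₂ k = λ e → s≤s (starDist-Lipschitz i j k e)
    ... | inj₂ i | inj₂ j | inj₁ k = λ e → s≤s (starDist-Lipschitz i j k e)
    ... | inj₂ i | inj₂ j | inj₂ k = starDist-Lipschitz i j k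
    ... | inj₁ i | inj₂ j | inj₁ k = λ e → subst (_≤ suc (suc (starDist j k))) (sym (starDist-congˡ i j k e)) (m≤n+m _ 2)
    ... | inj₁ i | inj₂ j | inj₂ k = λ e → s≤s (≤-reflexive (starDist-congˡ i j k e))
    ... | inj₂ i | inj₁ j | inj₁ k = λ e → s≤s (≤-reflexive (starDist-congˡ i j k e))
    ... | inj₂ i | inj₁ j | inj₂ k = λ e → subst (_≤ suc (suc (starDist j k))) (sym (starDist-congˡ i j k e)) (m≤n+m _ 2)

    dist-isDistance : ∀ u v → IsDistance (S² (suc m)) u v (dist u v)
    dist-isDistance u v = dist-walk u v , λ k k<d p →
      <⇒≱ k<d (Lipschitz-≤-walk (λ x → dist x v) (dist-Lipschitz v) (dist-refl v) p)

  sum-const : ∀ n c → sum {n} (λ _ → c) ≡ n * c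
  sum-const ℕ.zero    c = refl
  sum-const (ℕ.suc n) c = cong (c +_) (sum-const n c)

  sum-starDist : ∀ m → sum (λ i → sum (starDist {m} i)) ≡ m * (m * 2)
  sum-starDist m = begin
    sum {m} (λ _ → 1) + sum (λ i → suc (sum (leaf i)))     ≡⟨ ∑-distrib-+ (λ _ → 1) (λ i → suc (sum (leaf i))) ⟨
    sum (λ i → 2 + sum (leaf i))                           ≡⟨ sum-cong-≗ row ⟩
    sum {m} (λ _ → m * 2)                                  ≡⟨ sum-const m (m * 2) ⟩
    m * (m * 2)                                            ∎
    where
    leaf : Fin m → Fin m → ℕ
    leaf i j = if ⌊ i ≟ j ⌋ then 0 else 2
    row : ∀ i → 2 + sum (leaf i) ≡ m * 2
    row i = begin
      -- The 2 stands for the entries from centre to leaf and back; placed on the diagonal it fills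
      -- the only zero, and the row becomes constant.
      2 + sum (leaf i)                                                 ≡⟨ cong (_+ sum (leaf i)) (sum-δ +-0-isCommutativeMonoid i (λ _ → 2)) ⟨
      sum (λ j → if ⌊ i ≟ j ⌋ then 2 else 0) + sum (leaf i)            ≡⟨ ∑-distrib-+ (λ j → if ⌊ i ≟ j ⌋ then 2 else 0) (leaf i) ⟨
      sum (λ j → (if ⌊ i ≟ j ⌋ then 2 else 0) + leaf i j)              ≡⟨ sum-cong-≗ (λ j → complement ⌊ i ≟ j ⌋) ⟩
      sum {m} (λ _ → 2)                                                ≡⟨ sum-const m 2 ⟩
      m * 2                                                            ∎
      where
      complement : ∀ b → (if b then 2 else 0) + (if b then 0 else 2) ≡ 2
      complement true  = refl
      complement false = refl

  -- The Wiener index of S² (suc m); this summand order makes it reduce to a successor.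
  wienerIndex : ℕ → ℕ
  wienerIndex m = suc m * suc m + 4 * (m * m)

  -- All four blocks repeat the sum of star distances, and the two blocks across copies add 1 for
  -- each of their n² entries.
  sum-dist : ∀ m → sum (λ u → sum (dist {m} u)) ≡ wienerIndex m + wienerIndex m
  sum-dist m = begin
    sum (λ u → sum (dist {m} u))                                                            ≡⟨ sum-+ +-0-isCommutativeMonoid n n (λ u → sum (dist u)) ⟩
    sum (λ (i : Fin n) → sum (dist (lo i))) + sum (λ (i : Fin n) → sum (dist (hi i)))       ≡⟨ cong₂ _+_ (trans (sum-cong-≗ row-lo) rows) (trans (sum-cong-≗ row-hi) rows) ⟩
    (m * (m * 2) + (n * n + m * (m * 2))) + (m * (m * 2) + (n * n + m * (m * 2)))           ≡⟨ arith m ⟩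
    wienerIndex m + wienerIndex m                                                           ∎
    where
    n = suc m
    s : Fin n → ℕ
    s i = sum (starDist i)
    arith : ∀ m → (m * (m * 2) + (suc m * suc m + m * (m * 2))) + (m * (m * 2) + (suc m * suc m + m * (m * 2)))
                ≡ (suc m * suc m + 4 * (m * m)) + (suc m * suc m + 4 * (m * m))
    arith = solve-∀
    rung-row : ∀ i → sum (λ j → suc (starDist i j)) ≡ n + s i
    rung-row i = trans (∑-distrib-+ (λ _ → 1) (starDist i)) (cong (_+ s i) (trans (sum-const n 1) (*-identityʳ n)))
    row-lo : ∀ i → sum (dist (lo i)) ≡ s i + (n + s i)
    row-lo i = trans (sum-+ +-0-isCommutativeMonoid n n (dist (lo i))) (cong₂ _+_ (sum-cong-≗ (dist-lo-lo i)) (trans (sum-cong-≗ (dist-lo-hi i)) (rung-row i)))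
    row-hi : ∀ i → sum (dist (hi i)) ≡ s i + (n + s i)
    row-hi i = trans (sum-+ +-0-isCommutativeMonoid n n (dist (hi i)))
      (trans (cong₂ _+_ (trans (sum-cong-≗ (dist-hi-lo i)) (rung-row i)) (sum-cong-≗ (dist-hi-hi i))) (+-comm (n + s i) (s i)))
    rows : sum (λ i → s i + (n + s i)) ≡ m * (m * 2) + (n * n + m * (m * 2))
    rows = begin
      sum (λ i → s i + (n + s i))                         ≡⟨ ∑-distrib-+ s (λ i → n + s i) ⟩
      sum s + sum (λ i → n + s i)                         ≡⟨ cong (sum s +_) (∑-distrib-+ (λ _ → n) s) ⟩
      sum s + (sum {n} (λ _ → n) + sum s)                 ≡⟨ cong₂ (λ x y → x + (y + x)) (sum-starDist m) (sum-const n n) ⟩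
      m * (m * 2) + (n * n + m * (m * 2))                 ∎

  S²-isWienerIndex : ∀ m → IsWienerIndex (S² (suc m)) (wienerIndex m)
  S²-isWienerIndex m = dist , dist-isDistance , *-cancelʳ-≡ _ _ 2 (begin
    wienerIndex m * 2                      ≡⟨ double (wienerIndex m) ⟨
    wienerIndex m + wienerIndex m          ≡⟨ sum-dist m ⟨
    sum (λ u → sum (dist {m} u))           ≡⟨ sum-pairs +-0-isCommutativeMonoid (dist {m}) dist-sym dist-refl ⟨
    sumPairsℕ (dist {m}) + sumPairsℕ (dist {m})    ≡⟨ double (sumPairsℕ (dist {m})) ⟩
    sumPairsℕ (dist {m}) * 2               ∎)
    where
    double : ∀ x → x + x ≡ x * 2
    double = solve-∀

-- Convergence of the ratio to 8/15

module Limit where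
  open import Data.Integer as ℤ using (ℤ; +_; -[1+_])
  import Data.Integer.Properties as ℤ
  import Data.Integer.Tactic.RingSolver as ℤ-Solver
  open import Data.Nat as ℕ using (ℕ; suc; s≤s; z≤n)
  import Data.Nat.Properties as ℕ
  import Data.Nat.Tactic.RingSolver as ℕ-Solver
  open import Data.Nat.Coprimality using (Coprime)
  open import Data.Product using (∃; _,_)
  open import Data.Rational
  open import Data.Rational.Properties
  import Data.Rational.Unnormalised as ℚᵘ
  import Data.Rational.Unnormalised.Properties as ℚᵘ
  open import Relation.Binary.PropositionalEquality
  open Rationals
  open KirchhoffIndex
  open WienerIndex
  open Laplacian using (IsKirchhoffIndex-unique)
  open TwoCopies using (S²-sym)

  -- The numerator of A/(d+1) · 1/(w+1) - 8/15 over the unreduced common denominator. The factor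
  -- `+ 1` and the literal -8 are kept as unnormalised arithmetic produces them, so that the two
  -- agree by computation.
  differenceNumerator : ℤ → ℕ → ℕ → ℤ
  differenceNumerator A d w = A ℤ.* + 1 ℤ.* + 15 ℤ.+ -[1+ 7 ] ℤ.* + (suc d ℕ.* suc w)

  -- For unnormalised rationals the absolute value acts on the numerator alone, and the comparison
  -- with (p+1)/(q+1) is one cross multiplication.
  ratio-close : ∀ A d w p q-1 .(c : Coprime (suc p) (suc q-1)) →
          ℤ.∣ differenceNumerator A d w ∣ ℕ.* suc q-1 ℕ.< suc p ℕ.* (suc d ℕ.* suc w ℕ.* 15) →
          ∣ ((A / suc d) ÷ℕ suc w) - (+ 8 / 15) ∣ < mkℚ (+ suc p) q-1 c
  ratio-close A d w p q-1 c bound = toℚᵘ-cancel-< (ℚᵘ.<-respˡ-≃ (ℚᵘ.≃-sym expand) (ℚᵘ.*<* cross))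
    where
    x = (A / suc d) * (+ 1 / suc w)
    xᵘ = ℚᵘ.mkℚᵘ A d ℚᵘ.* ℚᵘ.mkℚᵘ (+ 1) w ℚᵘ.- ℚᵘ.mkℚᵘ (+ 8) 14
    expand : toℚᵘ ∣ x - (+ 8 / 15) ∣ ℚᵘ.≃ ℚᵘ.∣ xᵘ ∣
    expand = begin
      toℚᵘ ∣ x - (+ 8 / 15) ∣                                   ≈⟨ toℚᵘ-homo-∣-∣ (x - (+ 8 / 15)) ⟩
      ℚᵘ.∣ toℚᵘ (x - (+ 8 / 15)) ∣                              ≈⟨ ℚᵘ.∣-∣-cong (toℚᵘ-homo-+ x (- (+ 8 / 15))) ⟩
      ℚᵘ.∣ toℚᵘ x ℚᵘ.- ℚᵘ.mkℚᵘ (+ 8) 14 ∣                       ≈⟨ ℚᵘ.∣-∣-cong (ℚᵘ.+-congˡ (ℚᵘ.- ℚᵘ.mkℚᵘ (+ 8) 14) (toℚᵘ-homo-* (A / suc d) (+ 1 / suc w))) ⟩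
      ℚᵘ.∣ toℚᵘ (A / suc d) ℚᵘ.* toℚᵘ (+ 1 / suc w) ℚᵘ.- ℚᵘ.mkℚᵘ (+ 8) 14 ∣
        ≈⟨ ℚᵘ.∣-∣-cong (ℚᵘ.+-congˡ (ℚᵘ.- ℚᵘ.mkℚᵘ (+ 8) 14) (ℚᵘ.*-cong (toℚᵘ-/ A d) (toℚᵘ-/ (+ 1) w))) ⟩
      ℚᵘ.∣ xᵘ ∣                                                 ∎
      where open ℚᵘ.≃-Reasoning
    cross : (+ ℤ.∣ differenceNumerator A d w ∣) ℤ.* + suc q-1 ℤ.< + suc p ℤ.* + (suc d ℕ.* suc w ℕ.* 15)
    cross = subst₂ ℤ._<_ (ℤ.pos-* ℤ.∣ differenceNumerator A d w ∣ (suc q-1)) (ℤ.pos-* (suc p) (suc d ℕ.* suc w ℕ.* 15)) (ℤ.+<+ bound)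

  -- The cubic terms cancel, 15 · 8 against 8 · 3 · 5. All subtracted terms are moved across so that
  -- the polynomial identity is one of natural numbers; `cancel` moves them back in the integers.
  differenceNumerator≡ : ∀ m → let n = suc m in
    differenceNumerator (kirchhoffNumerator n) (5 ℕ.+ 3 ℕ.* n) (ℕ.pred (wienerIndex m)) ≡ + (78 ℕ.* n) ℤ.- + (3 ℕ.* (n ℕ.* n) ℕ.+ 12)
  differenceNumerator≡ m = cancel (+ X) (+ Y) (+ Z) (+ U) (+ V) (begin
    + X ℤ.* + 15 ℤ.+ + V                            ≡⟨ cong (ℤ._+ + V) (sym (ℤ.pos-* X 15)) ⟩
    + (X ℕ.* 15 ℕ.+ V)                              ≡⟨ cong +_ (identity m) ⟩
    + (Y ℕ.* 15 ℕ.+ 8 ℕ.* Z ℕ.+ U)                  ≡⟨ cong (ℤ._+ + U) (cong₂ ℤ._+_ (ℤ.pos-* Y 15) (ℤ.pos-* 8 Z)) ⟩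
    + Y ℤ.* + 15 ℤ.+ + 8 ℤ.* + Z ℤ.+ + U            ∎)
    where
    open ≡-Reasoning
    n = suc m
    X = 8 ℕ.* n ℕ.^ 3 ℕ.+ 3 ℕ.* n ℕ.^ 2 ℕ.+ 12
    Y = 14 ℕ.* n
    Z = (6 ℕ.+ 3 ℕ.* n) ℕ.* wienerIndex m
    U = 78 ℕ.* n
    V = 3 ℕ.* (n ℕ.* n) ℕ.+ 12
    identity : ∀ m → (8 ℕ.* (suc m ℕ.* (suc m ℕ.* (suc m ℕ.* 1))) ℕ.+ 3 ℕ.* (suc m ℕ.* (suc m ℕ.* 1)) ℕ.+ 12) ℕ.* 15 ℕ.+ (3 ℕ.* (suc m ℕ.* suc m) ℕ.+ 12)
                   ≡ 14 ℕ.* suc m ℕ.* 15 ℕ.+ 8 ℕ.* ((6 ℕ.+ 3 ℕ.* suc m) ℕ.* (suc m ℕ.* suc m ℕ.+ 4 ℕ.* (m ℕ.* m))) ℕ.+ 78 ℕ.* suc m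
    identity = ℕ-Solver.solve-∀
    cancel : ∀ x y z u v → x ℤ.* + 15 ℤ.+ v ≡ y ℤ.* + 15 ℤ.+ + 8 ℤ.* z ℤ.+ u → (x ℤ.- y) ℤ.* + 1 ℤ.* + 15 ℤ.+ -[1+ 7 ] ℤ.* z ≡ u ℤ.- v
    cancel x y z u v eq = begin
      (x ℤ.- y) ℤ.* + 1 ℤ.* + 15 ℤ.+ -[1+ 7 ] ℤ.* z                             ≡⟨ left x y z v ⟩
      (x ℤ.* + 15 ℤ.+ v) ℤ.- (y ℤ.* + 15 ℤ.+ + 8 ℤ.* z) ℤ.- v                   ≡⟨ cong (λ a → a ℤ.- (y ℤ.* + 15 ℤ.+ + 8 ℤ.* z) ℤ.- v) eq ⟩
      (y ℤ.* + 15 ℤ.+ + 8 ℤ.* z ℤ.+ u) ℤ.- (y ℤ.* + 15 ℤ.+ + 8 ℤ.* z) ℤ.- v     ≡⟨ right y z u v ⟩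
      u ℤ.- v                                                                   ∎
      where
      left : ∀ x y z v → (x ℤ.- y) ℤ.* + 1 ℤ.* + 15 ℤ.+ -[1+ 7 ] ℤ.* z ≡ (x ℤ.* + 15 ℤ.+ v) ℤ.- (y ℤ.* + 15 ℤ.+ + 8 ℤ.* z) ℤ.- v
      left = ℤ-Solver.solve-∀
      right : ∀ y z u v → (y ℤ.* + 15 ℤ.+ + 8 ℤ.* z ℤ.+ u) ℤ.- (y ℤ.* + 15 ℤ.+ + 8 ℤ.* z) ℤ.- v ≡ u ℤ.- v
      right = ℤ-Solver.solve-∀

  -- 93 = 78 + 3 + 12: for n ≥ 1 each monomial is at most its coefficient times n².
  numerator-bound : ∀ m → let n = suc m in 78 ℕ.* n ℕ.+ (3 ℕ.* (n ℕ.* n) ℕ.+ 12) ℕ.≤ 93 ℕ.* (n ℕ.* n)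
  numerator-bound m = subst (78 ℕ.* suc m ℕ.+ (3 ℕ.* (suc m ℕ.* suc m) ℕ.+ 12) ℕ.≤_) (slack m) (ℕ.m≤m+n _ _)
    where
    slack : ∀ m → 78 ℕ.* suc m ℕ.+ (3 ℕ.* (suc m ℕ.* suc m) ℕ.+ 12) ℕ.+ (78 ℕ.* (suc m ℕ.* m) ℕ.+ 12 ℕ.* (m ℕ.* m ℕ.+ m ℕ.+ m)) ≡ 93 ℕ.* (suc m ℕ.* suc m)
    slack = ℕ-Solver.solve-∀

  -- Keeping only 3n of the first factor and n² of the Wiener index, the right side exceeds 45 n³,
  -- with 45 = 3 · 15. By the hypothesis 45 n³ is at least 135 n² (q + 1), and 93 ≤ 135.
  cross-bound : ∀ m q → 3 ℕ.* suc q ℕ.≤ suc m → let n = suc m in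
                93 ℕ.* (n ℕ.* n) ℕ.* suc q ℕ.< (6 ℕ.+ 3 ℕ.* n) ℕ.* wienerIndex m ℕ.* 15
  cross-bound m q 3q≤n = begin-strict
    93 ℕ.* (n ℕ.* n) ℕ.* suc q                              ≤⟨ ℕ.*-monoˡ-≤ (suc q) (ℕ.*-monoˡ-≤ (n ℕ.* n) (ℕ.m≤m+n 93 42)) ⟩
    135 ℕ.* (n ℕ.* n) ℕ.* suc q                             ≡⟨ regroup (n ℕ.* n) (suc q) ⟩
    45 ℕ.* (n ℕ.* n) ℕ.* (3 ℕ.* suc q)                      ≤⟨ ℕ.*-monoʳ-≤ (45 ℕ.* (n ℕ.* n)) 3q≤n ⟩
    45 ℕ.* (n ℕ.* n) ℕ.* n                                  <⟨ ℕ.m<m+n _ (s≤s z≤n) ⟩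
    45 ℕ.* (n ℕ.* n) ℕ.* n ℕ.+ suc _                        ≡⟨ slack m ⟩
    (6 ℕ.+ 3 ℕ.* n) ℕ.* wienerIndex m ℕ.* 15                ∎
    where
    open ℕ.≤-Reasoning
    n = suc m
    regroup : ∀ a b → 135 ℕ.* a ℕ.* b ≡ 45 ℕ.* a ℕ.* (3 ℕ.* b)
    regroup = ℕ-Solver.solve-∀
    slack : ∀ m → 45 ℕ.* (suc m ℕ.* suc m) ℕ.* suc m ℕ.+ suc (89 ℕ.+ 90 ℕ.* (m ℕ.* m ℕ.+ m ℕ.+ m) ℕ.+ 60 ℕ.* ((9 ℕ.+ 3 ℕ.* m) ℕ.* (m ℕ.* m)))
                ≡ (6 ℕ.+ 3 ℕ.* suc m) ℕ.* (suc m ℕ.* suc m ℕ.+ 4 ℕ.* (m ℕ.* m)) ℕ.* 15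
    slack = ℕ-Solver.solve-∀

  ratio-limit : (ε : ℚ) → 0ℚ < ε → ∃ λ (N₀ : ℕ) → (n : ℕ) → N₀ ℕ.≤ n → (k : ℚ) → (w : ℕ) →
                IsKirchhoffIndex (S² n) k → IsWienerIndex (S² n) w → ∣ (k ÷ℕ w) - (+ 8 / 15) ∣ < ε
  ratio-limit (mkℚ (+ 0)      q c) (*<* (ℤ.+<+ ()))
  -- Here ε = (p+1)/(q+1) is at least 1/(q+1), so a threshold in `q` alone suffices. Being positive,
  -- it also excludes n = 0.
  ratio-limit (mkℚ (+ suc p)  q c) _ = 3 ℕ.* suc q , bound
    where
    bound : (n : ℕ) → 3 ℕ.* suc q ℕ.≤ n → (k : ℚ) → (w : ℕ) →
            IsKirchhoffIndex (S² n) k → IsWienerIndex (S² n) w → ∣ (k ÷ℕ w) - (+ 8 / 15) ∣ < mkℚ (+ suc p) q c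
    bound (suc m) 3q≤n k w k-index w-index =
      subst₂ (λ k w → ∣ (k ÷ℕ w) - (+ 8 / 15) ∣ < mkℚ (+ suc p) q c)
        (IsKirchhoffIndex-unique (S² (suc m)) (S²-sym (suc m)) (S²-isKirchhoffIndex m) k-index)
        (IsWienerIndex-unique (S²-isWienerIndex m) w-index)
        (ratio-close (kirchhoffNumerator n) (5 ℕ.+ 3 ℕ.* n) (ℕ.pred (wienerIndex m)) p q c (begin-strict
          ℤ.∣ differenceNumerator (kirchhoffNumerator n) (5 ℕ.+ 3 ℕ.* n) (ℕ.pred (wienerIndex m)) ∣ ℕ.* suc q
            ≡⟨ cong (λ z → ℤ.∣ z ∣ ℕ.* suc q) (differenceNumerator≡ m) ⟩
          ℤ.∣ + (78 ℕ.* n) ℤ.- + (3 ℕ.* (n ℕ.* n) ℕ.+ 12) ∣ ℕ.* suc q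
            ≤⟨ ℕ.*-monoˡ-≤ (suc q) (ℕ.≤-trans (ℤ.∣i-j∣≤∣i∣+∣j∣ (+ (78 ℕ.* n)) (+ (3 ℕ.* (n ℕ.* n) ℕ.+ 12))) (numerator-bound m)) ⟩
          93 ℕ.* (n ℕ.* n) ℕ.* suc q                        <⟨ cross-bound m q 3q≤n ⟩
          (6 ℕ.+ 3 ℕ.* n) ℕ.* wienerIndex m ℕ.* 15          ≤⟨ ℕ.m≤n*m _ (suc p) ⟩
          suc p ℕ.* ((6 ℕ.+ 3 ℕ.* n) ℕ.* wienerIndex m ℕ.* 15) ∎))
      where
      open ℕ.≤-Reasoning
      n = suc m
  ratio-limit (mkℚ (-[1+ p ]) q c) (*<* ())

-- Counting sublists by bit masks

module SublistCounting where
  open import Data.Bool using (Bool; true; false; if_then_else_; _∧_)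
  open import Data.Bool.Properties using (∧-zeroʳ)
  open import Data.Fin using (Fin; zero; suc)
  open import Data.List using (List; []; _∷_; _++_; length; filterᵇ; map; tabulate)
  open import Data.List.Relation.Unary.All using (All; []; _∷_)
  open import Data.List.Membership.Propositional using (_∈_)
  open import Data.List.Relation.Unary.Any using (here; there)
  open import Data.Nat using (ℕ; zero; suc; _+_; _*_; _^_; _≡ᵇ_)
  open import Data.Nat.Tactic.RingSolver using (solve-∀)
  open import Data.Product using (∃; _×_; _,_)
  open import Data.Vec using (Vec; []; _∷_; lookup)
  open import Function using (_∘_)
  open import Relation.Binary.PropositionalEquality
  open ≡-Reasoning

  indicator : Bool → ℕ
  indicator b = if b then 1 else 0

  count : {A : Set} → (List A → Bool) → List A → ℕ
  count P xs = length (filterᵇ P (sublists xs))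

  count-∷ : {A : Set} (P : List A → Bool) (x : A) (xs : List A) → count P (x ∷ xs) ≡ count P xs + count (P ∘ (x ∷_)) xs
  count-∷ {A} P x xs = trans (filter-++ (sublists xs) (map (x ∷_) (sublists xs))) (cong (count P xs +_) (filter-map (sublists xs)))
    where
    filter-++ : ∀ ys zs → length (filterᵇ P (ys ++ zs)) ≡ length (filterᵇ P ys) + length (filterᵇ P zs)
    filter-++ []       zs = refl
    filter-++ (y ∷ ys) zs with P y
    ... | true  = cong suc (filter-++ ys zs)
    ... | false = filter-++ ys zs
    filter-map : ∀ ys → length (filterᵇ P (map (x ∷_) ys)) ≡ length (filterᵇ (P ∘ (x ∷_)) ys)
    filter-map []       = refl
    filter-map (y ∷ ys) with P (x ∷ y)
    ... | true  = cong suc (filter-map ys)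
    ... | false = filter-map ys

  count-[] : {A : Set} (P : List A → Bool) → count P [] ≡ indicator (P [])
  count-[] P with P []
  ... | true  = refl
  ... | false = refl

  -- Branches as `sublists` does, first without the head and then with it, so that the two unfold in
  -- step.
  maskSum : ∀ m → (Vec Bool m → ℕ) → ℕ
  maskSum zero    f = f []
  maskSum (suc m) f = maskSum m (λ v → f (false ∷ v)) + maskSum m (λ v → f (true ∷ v))

  maskSum-cong : ∀ m {f g : Vec Bool m → ℕ} → (∀ v → f v ≡ g v) → maskSum m f ≡ maskSum m g
  maskSum-cong zero    f≗g = f≗g []
  maskSum-cong (suc m) f≗g = cong₂ _+_ (maskSum-cong m (λ v → f≗g (false ∷ v))) (maskSum-cong m (λ v → f≗g (true ∷ v)))

  maskSum-0 : ∀ m → maskSum m (λ _ → 0) ≡ 0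
  maskSum-0 zero    = refl
  maskSum-0 (suc m) = cong₂ _+_ (maskSum-0 m) (maskSum-0 m)

  maskSum-+ : ∀ m (f g : Vec Bool m → ℕ) → maskSum m (λ v → f v + g v) ≡ maskSum m f + maskSum m g
  maskSum-+ zero    f g = refl
  maskSum-+ (suc m) f g = trans
    (cong₂ _+_ (maskSum-+ m (λ v → f (false ∷ v)) (λ v → g (false ∷ v))) (maskSum-+ m (λ v → f (true ∷ v)) (λ v → g (true ∷ v))))
    (interchange (maskSum m (λ v → f (false ∷ v))) (maskSum m (λ v → g (false ∷ v))) (maskSum m (λ v → f (true ∷ v))) (maskSum m (λ v → g (true ∷ v))))
    where
    interchange : ∀ a b c d → (a + b) + (c + d) ≡ (a + c) + (b + d)
    interchange = solve-∀

  select : ∀ {A : Set} {m} → (Fin m → A) → Vec Bool m → List A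
  select f []          = []
  select f (false ∷ v) = select (f ∘ suc) v
  select f (true  ∷ v) = f zero ∷ select (f ∘ suc) v

  ones : ∀ {m} → Vec Bool m → ℕ
  ones []      = 0
  ones (b ∷ v) = indicator b + ones v

  length-select : ∀ {A : Set} {m} (f : Fin m → A) v → length (select f v) ≡ ones v
  length-select f []          = refl
  length-select f (false ∷ v) = length-select (f ∘ suc) v
  length-select f (true  ∷ v) = cong suc (length-select (f ∘ suc) v)

  select-∈ : ∀ {A : Set} {m} (f : Fin m → A) v i → lookup v i ≡ true → f i ∈ select f v
  select-∈ f (true  ∷ v) zero    _  = here refl
  select-∈ f (false ∷ v) (suc i) eq = select-∈ (f ∘ suc) v i eq
  select-∈ f (true  ∷ v) (suc i) eq = there (select-∈ (f ∘ suc) v i eq)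

  select-All : ∀ {A : Set} {P : A → Set} {m} (f : Fin m → A) v → (∀ i → lookup v i ≡ true → P (f i)) → All P (select f v)
  select-All f []          p = []
  select-All f (false ∷ v) p = select-All (f ∘ suc) v (p ∘ suc)
  select-All f (true  ∷ v) p = p zero refl ∷ select-All (f ∘ suc) v (p ∘ suc)

  -- Consumes one block of the list and passes the rest on with a modified predicate, so a list made
  -- of several blocks is handled by iteration.
  count-tabulate-++ : ∀ {A : Set} {m} (P : List A → Bool) (f : Fin m → A) xs →
                      count P (tabulate f ++ xs) ≡ maskSum m (λ v → count (λ T → P (select f v ++ T)) xs)
  count-tabulate-++ {m = zero}  P f xs = refl
  count-tabulate-++ {m = suc m} P f xs = trans (count-∷ P (f zero) (tabulate (f ∘ suc) ++ xs))
    (cong₂ _+_ (count-tabulate-++ P (f ∘ suc) xs) (count-tabulate-++ (P ∘ (f zero ∷_)) (f ∘ suc) xs))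

  maskSum³ : ∀ m → (Vec Bool m → Vec Bool m → Vec Bool m → ℕ) → ℕ
  maskSum³ m f = maskSum m (λ α → maskSum m (λ ρ → maskSum m (λ β → f α ρ β)))

  maskSum³-cong : ∀ m {f g : Vec Bool m → Vec Bool m → Vec Bool m → ℕ} → (∀ α ρ β → f α ρ β ≡ g α ρ β) → maskSum³ m f ≡ maskSum³ m g
  maskSum³-cong m eq = maskSum-cong m (λ α → maskSum-cong m (λ ρ → maskSum-cong m (λ β → eq α ρ β)))

  maskSum³-0 : ∀ m → maskSum³ m (λ _ _ _ → 0) ≡ 0
  maskSum³-0 m = trans (maskSum-cong m (λ α → trans (maskSum-cong m (λ ρ → maskSum-0 m)) (maskSum-0 m))) (maskSum-0 m)

  -- Regroups masks given per kind of edge so that the three bits of the first page stand together.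
  maskSum³-suc : ∀ m f → let s : Bool → Bool → Bool → ℕ
                             s = λ a r b → maskSum³ m (λ α ρ β → f (a ∷ α) (r ∷ ρ) (b ∷ β)) in
    maskSum³ (suc m) f ≡ ((s false false false + s false false true) + (s false true false + s false true true))
                       + ((s true false false + s true false true) + (s true true false + s true true true))
  maskSum³-suc m f = cong₂ _+_ (half false) (half true)
    where
    quarter : ∀ a r → maskSum m (λ α → maskSum m (λ ρ → maskSum (suc m) (f (a ∷ α) (r ∷ ρ))))
            ≡ maskSum³ m (λ α ρ β → f (a ∷ α) (r ∷ ρ) (false ∷ β)) + maskSum³ m (λ α ρ β → f (a ∷ α) (r ∷ ρ) (true ∷ β))
    quarter a r = trans (maskSum-cong m (λ α → maskSum-+ m _ _)) (maskSum-+ m _ _)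
    half : ∀ a → maskSum m (λ α → maskSum (suc m) (λ ρ → maskSum (suc m) (f (a ∷ α) ρ)))
         ≡ (maskSum³ m (λ α ρ β → f (a ∷ α) (false ∷ ρ) (false ∷ β)) + maskSum³ m (λ α ρ β → f (a ∷ α) (false ∷ ρ) (true ∷ β)))
         + (maskSum³ m (λ α ρ β → f (a ∷ α) (true ∷ ρ) (false ∷ β)) + maskSum³ m (λ α ρ β → f (a ∷ α) (true ∷ ρ) (true ∷ β)))
    half a = trans (maskSum-+ m _ _) (cong₂ _+_ (quarter a false) (quarter a true))

  -- Bits i of the masks α, ρ, β tell which edges of page i are chosen: first copy, rung, second copy.
  atLeastTwo : Bool → Bool → Bool → Bool
  atLeastTwo false r b = r ∧ b
  atLeastTwo true  r b = if r then true else b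

  sound : ∀ {m} → Vec Bool m → Vec Bool m → Vec Bool m → Bool
  sound []      []      []      = true
  sound (a ∷ α) (r ∷ ρ) (b ∷ β) = atLeastTwo a r b ∧ sound α ρ β

  full : ∀ {m} → Vec Bool m → Vec Bool m → Vec Bool m → ℕ
  full []      []      []      = 0
  full (a ∷ α) (r ∷ ρ) (b ∷ β) = indicator (a ∧ r ∧ b) + full α ρ β

  soundWithFull : ∀ m → ℕ → ℕ
  soundWithFull m c = maskSum³ m (λ α ρ β → indicator (sound α ρ β ∧ (full α ρ β ≡ᵇ c)))

  soundWithFull-suc-0 : ∀ m → soundWithFull (suc m) 0 ≡ 3 * soundWithFull m 0
  soundWithFull-suc-0 m = begin
    soundWithFull (suc m) 0                         ≡⟨ maskSum³-suc m (λ α ρ β → indicator (sound α ρ β ∧ (full α ρ β ≡ᵇ 0))) ⟩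
    -- Of the eight patterns of the first page, four are unsound (`z`), three keep two edges (`h`),
    -- and the full one (`y`) contradicts the count 0.
    ((z + z) + (z + h)) + ((z + h) + (h + y))       ≡⟨ cong₂ (λ z y → ((z + z) + (z + h)) + ((z + h) + (h + y))) (maskSum³-0 m) y≡0 ⟩
    h + (h + (h + 0))                               ∎
    where
    z = maskSum³ m (λ _ _ _ → 0)
    h = soundWithFull m 0
    y = maskSum³ m (λ α ρ β → indicator (sound α ρ β ∧ false))
    y≡0 : y ≡ 0
    y≡0 = trans (maskSum³-cong m (λ α ρ β → cong indicator (∧-zeroʳ (sound α ρ β)))) (maskSum³-0 m)

  soundWithFull-suc-1 : ∀ m → soundWithFull (suc m) 1 ≡ 3 * soundWithFull m 1 + soundWithFull m 0
  soundWithFull-suc-1 m = begin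
    soundWithFull (suc m) 1                         ≡⟨ maskSum³-suc m (λ α ρ β → indicator (sound α ρ β ∧ (full α ρ β ≡ᵇ 1))) ⟩
    -- Now a full first page is allowed, and then no other page may be full.
    ((z + z) + (z + h)) + ((z + h) + (h + y))       ≡⟨ cong (λ z → ((z + z) + (z + h)) + ((z + h) + (h + y))) (maskSum³-0 m) ⟩
    h + (h + (h + y))                               ≡⟨ regroup h y ⟩
    3 * h + y                                       ∎
    where
    z = maskSum³ m (λ _ _ _ → 0)
    h = soundWithFull m 1
    y = soundWithFull m 0
    regroup : ∀ h y → h + (h + (h + y)) ≡ 3 * h + y
    regroup = solve-∀

  soundWithFull-0 : ∀ m → soundWithFull m 0 ≡ 3 ^ m
  soundWithFull-0 zero    = refl
  soundWithFull-0 (suc m) = trans (soundWithFull-suc-0 m) (cong (3 *_) (soundWithFull-0 m))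

  -- Choose the full page, then the missing edge of each other page. Stating it at `suc m` keeps
  -- subtraction out of the exponent.
  soundWithFull-1 : ∀ m → soundWithFull (suc m) 1 ≡ suc m * 3 ^ m
  soundWithFull-1 zero    = refl
  soundWithFull-1 (suc m) = begin
    soundWithFull (suc (suc m)) 1                             ≡⟨ soundWithFull-suc-1 (suc m) ⟩
    3 * soundWithFull (suc m) 1 + soundWithFull (suc m) 0     ≡⟨ cong₂ (λ x y → 3 * x + y) (soundWithFull-1 m) (soundWithFull-0 (suc m)) ⟩
    3 * (suc m * 3 ^ m) + 3 * 3 ^ m                           ≡⟨ regroup m (3 ^ m) ⟩
    suc (suc m) * (3 * 3 ^ m)                                 ∎
    where
    regroup : ∀ m p → 3 * (suc m * p) + 3 * p ≡ suc (suc m) * (3 * p)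
    regroup = solve-∀

  sound-lookup : ∀ {m} (α ρ β : Vec Bool m) → sound α ρ β ≡ true → ∀ i → atLeastTwo (lookup α i) (lookup ρ i) (lookup β i) ≡ true
  sound-lookup (a ∷ α) (r ∷ ρ) (b ∷ β) eq i with atLeastTwo a r b in page | i
  ... | true  | zero   = page
  ... | true  | suc i′ = sound-lookup α ρ β eq i′
  sound-lookup (a ∷ α) (r ∷ ρ) (b ∷ β) () i | false | _

  unsound-lookup : ∀ {m} (α ρ β : Vec Bool m) → sound α ρ β ≡ false → ∃ λ i → atLeastTwo (lookup α i) (lookup ρ i) (lookup β i) ≡ false
  unsound-lookup [] [] [] ()
  unsound-lookup (a ∷ α) (r ∷ ρ) (b ∷ β) eq with atLeastTwo a r b in page
  ... | false = zero , page
  ... | true  with i , eq′ ← unsound-lookup α ρ β eq = suc i , eq′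

  full-lookup : ∀ {m k} (α ρ β : Vec Bool m) → full α ρ β ≡ suc k →
                ∃ λ i → lookup α i ≡ true × lookup ρ i ≡ true × lookup β i ≡ true
  full-lookup [] [] [] ()
  full-lookup (true  ∷ α) (true  ∷ ρ) (true  ∷ β) _ = zero , refl , refl , refl
  full-lookup (false ∷ α) (r     ∷ ρ) (b     ∷ β) eq with i , p ← full-lookup α ρ β eq = suc i , p
  full-lookup (true  ∷ α) (false ∷ ρ) (b     ∷ β) eq with i , p ← full-lookup α ρ β eq = suc i , p
  full-lookup (true  ∷ α) (true  ∷ ρ) (false ∷ β) eq with i , p ← full-lookup α ρ β eq = suc i , p

  -- Each page holds exactly two chosen edges, and a third if it is full.
  sound-ones : ∀ {m} (α ρ β : Vec Bool m) → sound α ρ β ≡ true → ones α + (ones ρ + ones β) ≡ full α ρ β + (m + m)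
  sound-ones [] [] [] _ = refl
  sound-ones {suc m} (a ∷ α) (r ∷ ρ) (b ∷ β) eq with atLeastTwo a r b in page
  ... | true = begin
    (indicator a + ones α) + ((indicator r + ones ρ) + (indicator b + ones β))
      ≡⟨ regroup₁ (indicator a) (indicator r) (indicator b) (ones α) (ones ρ) (ones β) ⟩
    (indicator a + (indicator r + indicator b)) + (ones α + (ones ρ + ones β))   ≡⟨ cong₂ _+_ (excess a r b page) (sound-ones α ρ β eq) ⟩
    (indicator (a ∧ r ∧ b) + 2) + (full α ρ β + (m + m))                         ≡⟨ regroup₂ (indicator (a ∧ r ∧ b)) (full α ρ β) m ⟩
    (indicator (a ∧ r ∧ b) + full α ρ β) + (suc m + suc m)                       ∎
    where
    regroup₁ : ∀ a r b x y z → (a + x) + ((r + y) + (b + z)) ≡ (a + (r + b)) + (x + (y + z))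
    regroup₁ = solve-∀
    regroup₂ : ∀ e f m → (e + 2) + (f + (m + m)) ≡ (e + f) + (suc m + suc m)
    regroup₂ = solve-∀
    excess : ∀ a r b → atLeastTwo a r b ≡ true → indicator a + (indicator r + indicator b) ≡ indicator (a ∧ r ∧ b) + 2
    excess false true  true  _ = refl
    excess true  false true  _ = refl
    excess true  true  false _ = refl
    excess true  true  true  _ = refl

-- Reachability, walks and cuts

module Connectivity where
  open import Data.Bool using (Bool; true; false; _∧_; _∨_)
  open import Data.Bool.ListAction using (any; all)
  open import Data.Bool.Properties using (∨-zeroʳ)
  open import Data.Fin using (Fin; zero; suc; toℕ)
  open import Data.Fin.Properties using (_≟_; pigeonhole; toℕ≤pred[n])
  open import Data.List using (List; []; _∷_; allFin)
  open import Data.List.Membership.Propositional using (_∈_)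
  open import Data.List.Membership.Propositional.Properties using (∈-allFin)
  open import Data.List.Relation.Unary.All using (All; []; _∷_)
  open import Data.List.Relation.Unary.Any using (here; there)
  open import Data.Nat using (ℕ; zero; suc; _+_; _∸_; _≤_; _<_; s≤s)
  open import Data.Nat.Induction using (<-rec)
  open import Data.Nat.Properties using (_<?_; ≮⇒≥; <⇒≤; +-monoˡ-<; m+[n∸m]≡n; module ≤-Reasoning)
  open import Data.Product using (∃; _×_; _,_; proj₁; proj₂; swap)
  open import Relation.Binary.PropositionalEquality
  open import Relation.Nullary using (yes; no; contradiction)
  open import Relation.Nullary.Decidable using (⌊_⌋)
  open TwoCopies using (⌊≟⌋-refl)

  module _ {N : ℕ} {G : Graph N} where
    infixr 5 _++ʷ_
    _++ʷ_ : ∀ {u v w k l} → Walk G u v k → Walk G v w l → Walk G u w (k + l)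
    here     ++ʷ q = q
    step e p ++ʷ q = step e (p ++ʷ q)

    vertexAt : ∀ {u v k} → Walk G u v k → Fin (suc k) → Fin N
    vertexAt {u} p          zero    = u
    vertexAt     (step e p) (suc i) = vertexAt p i

    takeʷ : ∀ {u v k} (p : Walk G u v k) i → Walk G u (vertexAt p i) (toℕ i)
    takeʷ p          zero    = here
    takeʷ (step e p) (suc i) = step e (takeʷ p i)

    dropʷ : ∀ {u v k} (p : Walk G u v k) i → Walk G (vertexAt p i) v (k ∸ toℕ i)
    dropʷ p          zero    = p
    dropʷ (step e p) (suc i) = dropʷ p i

    -- A walk of length at least N lists more than N vertices, so two coincide and the loop between
    -- them can be cut out. `connectedᵇ` explores only N rounds, hence the bound.
    shortWalk : ∀ {u v} k → Walk G u v k → ∃ λ l → l < N × Walk G u v l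
    shortWalk {u} {v} = <-rec (λ k → Walk G u v k → ∃ λ l → l < N × Walk G u v l) cutLoop
      where
      cutLoop : ∀ k → (∀ {l} → l < k → Walk G u v l → ∃ λ l → l < N × Walk G u v l) → Walk G u v k → ∃ λ l → l < N × Walk G u v l
      cutLoop k rec p with k <? N
      ... | yes k<N = k , k<N , p
      ... | no  k≮N with i , j , i<j , eq ← pigeonhole (s≤s (≮⇒≥ k≮N)) (vertexAt p) =
        rec shorter (subst (λ x → Walk G u x (toℕ i)) eq (takeʷ p i) ++ʷ dropʷ p j)
        where
        open ≤-Reasoning
        shorter : toℕ i + (k ∸ toℕ j) < k
        shorter = begin-strict
          toℕ i + (k ∸ toℕ j)    <⟨ +-monoˡ-< (k ∸ toℕ j) i<j ⟩
          toℕ j + (k ∸ toℕ j)    ≡⟨ m+[n∸m]≡n (toℕ≤pred[n] j) ⟩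
          k                      ∎

  module _ {A : Set} (p : A → Bool) where
    any-∈ : ∀ {x xs} → x ∈ xs → p x ≡ true → any p xs ≡ true
    any-∈ {xs = y ∷ ys} (here refl) px rewrite px = refl
    any-∈ {xs = y ∷ ys} (there x∈) px = trans (cong (p y ∨_) (any-∈ x∈ px)) (∨-zeroʳ (p y))

    all-∈ : ∀ {x xs} → all p xs ≡ true → x ∈ xs → p x ≡ true
    all-∈ {xs = y ∷ ys} eq x∈ with p y in py
    all-∈ {xs = y ∷ ys} eq (here refl) | true = py
    all-∈ {xs = y ∷ ys} eq (there x∈)  | true = all-∈ eq x∈

    all-true : ∀ xs → (∀ x → p x ≡ true) → all p xs ≡ true
    all-true []       _  = refl
    all-true (x ∷ xs) px = cong₂ _∧_ (px x) (all-true xs px)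

  module _ {N : ℕ} (T : List (Fin N × Fin N)) where
    -- Phrased as the edge test of `reachStep` for the singleton of `u`, which makes the comparison
    -- with `reach` direct.
    adjacent : Graph N
    adjacent u v = any (λ e → (⌊ u ≟ proj₁ e ⌋ ∧ ⌊ v ≟ proj₂ e ⌋) ∨ (⌊ u ≟ proj₂ e ⌋ ∧ ⌊ v ≟ proj₁ e ⌋)) T

    reachStep-mono : ∀ S v → S v ≡ true → reachStep T S v ≡ true
    reachStep-mono S v Sv rewrite Sv = refl

    reach-mono : ∀ k S v → S v ≡ true → reach T k S v ≡ true
    reach-mono zero    S v Sv = Sv
    reach-mono (suc k) S v Sv = reach-mono k (reachStep T S) v (reachStep-mono S v Sv)

    -- An edge that passes the test for the singleton of `u` passes it for any `S` containing `u`.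
    reachStep-adjacent : ∀ S u v → S u ≡ true → adjacent u v ≡ true → reachStep T S v ≡ true
    reachStep-adjacent S u v Su adj = trans (cong (S v ∨_) (scan T adj)) (∨-zeroʳ (S v))
      where
      incident : (Fin N → Bool) → Fin N × Fin N → Bool
      incident S e = (S (proj₁ e) ∧ ⌊ v ≟ proj₂ e ⌋) ∨ (S (proj₂ e) ∧ ⌊ v ≟ proj₁ e ⌋)
      incident-u : ∀ e → incident (λ w → ⌊ u ≟ w ⌋) e ≡ true → incident S e ≡ true
      incident-u (x , y) eq with u ≟ x | u ≟ y
      incident-u (x , y) eq | yes refl | yes refl rewrite Su = eq
      incident-u (x , y) eq | yes refl | no  _    with v ≟ y
      incident-u (x , y) eq | yes refl | no  _ | yes _ rewrite Su = refl
      incident-u (x , y) eq | no _ | yes refl rewrite Su | eq = ∨-zeroʳ _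
      scan : ∀ xs → any (incident (λ w → ⌊ u ≟ w ⌋)) xs ≡ true → any (incident S) xs ≡ true
      scan (e ∷ xs) eq with incident (λ w → ⌊ u ≟ w ⌋) e in eq₁
      ... | true  rewrite incident-u e eq₁ = refl
      ... | false = trans (cong (incident S e ∨_) (scan xs eq)) (∨-zeroʳ (incident S e))

    reach-walk : ∀ {u v l k} → Walk adjacent u v l → l ≤ k → ∀ S → S u ≡ true → reach T k S v ≡ true
    reach-walk {v = v} {k = k} here _ S Su = reach-mono k S v Su
    reach-walk {k = suc k} (step {u} {w} e p) (s≤s l≤k) S Su =
      reach-walk p l≤k (reachStep T S) (reachStep-adjacent S u w Su e)

    -- Carrying walks in both directions makes symmetry a swap instead of the reversal of a walk.
    Linked : Fin N → Fin N → Set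
    Linked u v = (∃ λ k → Walk adjacent u v k) × (∃ λ k → Walk adjacent v u k)

    linked-refl : ∀ {u} → Linked u u
    linked-refl = (0 , here) , (0 , here)

    linked-sym : ∀ {u v} → Linked u v → Linked v u
    linked-sym = swap

    linked-trans : ∀ {u v w} → Linked u v → Linked v w → Linked u w
    linked-trans ((_ , p) , (_ , p′)) ((_ , q) , (_ , q′)) = (_ , p ++ʷ q) , (_ , q′ ++ʷ p′)

    linked-edge : ∀ {u v} → (u , v) ∈ T → Linked u v
    linked-edge {u} {v} e∈T = (1 , step (any-∈ _ e∈T forward) here) , (1 , step (any-∈ _ e∈T backward) here)
      where
      forward : (⌊ u ≟ u ⌋ ∧ ⌊ v ≟ v ⌋) ∨ (⌊ u ≟ v ⌋ ∧ ⌊ v ≟ u ⌋) ≡ true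
      forward rewrite ⌊≟⌋-refl u | ⌊≟⌋-refl v = refl
      backward : (⌊ v ≟ u ⌋ ∧ ⌊ u ≟ v ⌋) ∨ (⌊ v ≟ v ⌋ ∧ ⌊ u ≟ u ⌋) ≡ true
      backward rewrite ⌊≟⌋-refl u | ⌊≟⌋-refl v = ∨-zeroʳ _

    -- Any two vertices are joined through `r`, and the resulting walk is shortened to fit the
    -- rounds of `reach`.
    linked⇒connectedᵇ : ∀ r → (∀ v → Linked r v) → connectedᵇ T ≡ true
    linked⇒connectedᵇ r linked = all-true _ (allFin N) (λ u → all-true _ (allFin N) (λ v → reached u v))
      where
      reached : ∀ u v → reach T N (λ w → ⌊ u ≟ w ⌋) v ≡ true
      reached u v with (k , p) , _ ← linked-trans (linked-sym (linked u)) (linked v)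
        with l , l<N , q ← shortWalk k p = reach-walk q (<⇒≤ l<N) (λ w → ⌊ u ≟ w ⌋) (⌊≟⌋-refl u)

    module _ (C : Fin N → Bool) (closed : All (λ e → C (proj₁ e) ≡ C (proj₂ e)) T) where
      reachStep-closed : ∀ S → (∀ v → S v ≡ true → C v ≡ true) → ∀ v → reachStep T S v ≡ true → C v ≡ true
      reachStep-closed S S⊆C v eq with S v in Sv
      ... | true  = S⊆C v Sv
      ... | false = scan T closed eq
        where
        scan : ∀ xs → All (λ e → C (proj₁ e) ≡ C (proj₂ e)) xs →
               any (λ e → (S (proj₁ e) ∧ ⌊ v ≟ proj₂ e ⌋) ∨ (S (proj₂ e) ∧ ⌊ v ≟ proj₁ e ⌋)) xs ≡ true → C v ≡ true
        scan ((x , y) ∷ xs) (Cx≡Cy ∷ cl) eq with S x in Sx | v ≟ y | S y in Sy | v ≟ x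
        ... | true  | yes refl | _     | _        = trans (sym Cx≡Cy) (S⊆C x Sx)
        ... | true  | no  _    | true  | yes refl = S⊆C x Sx
        ... | true  | no  _    | true  | no _     = scan xs cl eq
        ... | true  | no  _    | false | _        = scan xs cl eq
        ... | false | _        | true  | yes refl = trans Cx≡Cy (S⊆C y Sy)
        ... | false | _        | true  | no _     = scan xs cl eq
        ... | false | _        | false | _        = scan xs cl eq

      reach-closed : ∀ k S → (∀ v → S v ≡ true → C v ≡ true) → ∀ v → reach T k S v ≡ true → C v ≡ true
      reach-closed zero    S S⊆C = S⊆C
      reach-closed (suc k) S S⊆C = reach-closed k (reachStep T S) (reachStep-closed S S⊆C)

      -- No edge crosses the boundary of `C`, so the set reached from `u` stays inside and misses
      -- `v`.
      cut⇒disconnected : ∀ u v → C u ≡ true → C v ≡ false → connectedᵇ T ≡ false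
      cut⇒disconnected u v Cu Cv with connectedᵇ T in conn
      ... | false = refl
      ... | true  = contradiction (trans (sym Cv) Cv′) λ ()
        where
        start : ∀ w → ⌊ u ≟ w ⌋ ≡ true → C w ≡ true
        start w _ with yes refl ← u ≟ w = Cu
        Cv′ : C v ≡ true
        Cv′ = reach-closed N (λ w → ⌊ u ≟ w ⌋) start v (all-∈ _ (all-∈ _ conn (∈-allFin u)) (∈-allFin v))

-- The edge list of the product, computed explicitly

module EdgeList where
  open import Data.Bool using (if_then_else_; _∧_)
  open import Data.Bool.Properties using (∧-zeroʳ)
  open import Data.Fin using (Fin; zero; suc; toℕ; _↑ˡ_; _↑ʳ_)
  open import Data.Fin.Properties using (_≟_; toℕ-↑ˡ; toℕ-↑ʳ; toℕ<n; suc-injective)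
  open import Data.List using (List; []; _∷_; _++_; concat; concatMap; tabulate; allFin)
  open import Data.List.Properties using (map-tabulate; ++-assoc; tabulate-cong)
  open import Data.Nat using (ℕ; zero; suc; _+_; _<ᵇ_)
  open import Data.Nat.Properties using (<-≤-trans; m≤m+n; <⇒≯)
  open import Data.Product using (_×_; _,_)
  open import Function using (_∘_; id)
  open import Relation.Binary.PropositionalEquality
  open import Relation.Nullary.Decidable using (⌊_⌋)
  open FiniteSums using (<⇒<ᵇ≡true; ≮⇒<ᵇ≡false)
  open TwoCopies
  open ≡-Reasoning

  module _ {A : Set} where
    cat : ∀ {n} → (Fin n → List A) → List A
    cat f = concat (tabulate f)

    concatMap-allFin : ∀ {n} (f : Fin n → List A) → concatMap f (allFin n) ≡ cat f
    concatMap-allFin f = cong concat (map-tabulate id f)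

    cat-cong : ∀ {n} {f g : Fin n → List A} → (∀ i → f i ≡ g i) → cat f ≡ cat g
    cat-cong f≗g = cong concat (tabulate-cong f≗g)

    cat-+ : ∀ m n (f : Fin (m + n) → List A) → cat f ≡ cat (λ i → f (i ↑ˡ n)) ++ cat (λ i → f (m ↑ʳ i))
    cat-+ zero    n f = refl
    cat-+ (suc m) n f = trans (cong (f zero ++_) (cat-+ m n (f ∘ suc))) (sym (++-assoc (f zero) _ _))

    cat-[] : ∀ n → cat {n} (λ _ → []) ≡ []
    cat-[] zero    = refl
    cat-[] (suc n) = cat-[] n

    cat-singleton : ∀ {n} (f : Fin n → A) → cat (λ i → f i ∷ []) ≡ tabulate f
    cat-singleton {zero}  f = refl
    cat-singleton {suc n} f = cong (f zero ∷_) (cat-singleton (f ∘ suc))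

    cat-δ : ∀ {n} (i : Fin n) (f : Fin n → A) → cat (λ j → if ⌊ i ≟ j ⌋ then f j ∷ [] else []) ≡ f i ∷ []
    cat-δ {suc n} zero    f = cong (f zero ∷_) (cat-[] n)
    cat-δ {suc n} (suc i) f = trans (cat-cong (λ j → cong (if_then f (suc j) ∷ [] else []) (⌊≟⌋-injective suc suc-injective i j))) (cat-δ i (f ∘ suc))

  <ᵇ-cancel : ∀ k x y → (k + x <ᵇ k + y) ≡ (x <ᵇ y)
  <ᵇ-cancel zero    x y = refl
  <ᵇ-cancel (suc k) x y = <ᵇ-cancel k x y

  module _ (m : ℕ) where
    private
      n = suc m
      Edge = Fin (n + n) × Fin (n + n)

    railLo rung railHi : Fin m → Edge
    railLo i = lo zero , lo (suc i)
    rung   i = lo (suc i) , hi (suc i)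
    railHi i = hi zero , hi (suc i)

    spine : Edge
    spine = lo zero , hi zero

    entry : Fin (n + n) → Fin (n + n) → List Edge
    entry u v = if (toℕ u <ᵇ toℕ v) ∧ S² n u v then (u , v) ∷ [] else []

    entry-cong : ∀ u v {x y} → (toℕ u <ᵇ toℕ v) ≡ x → S² n u v ≡ y → entry u v ≡ (if x ∧ y then (u , v) ∷ [] else [])
    entry-cong u v = cong₂ (λ x y → if x ∧ y then (u , v) ∷ [] else [])

    entry-lo-lo : ∀ i j → entry (lo i) (lo j) ≡ (if (toℕ i <ᵇ toℕ j) ∧ star n i j then (lo i , lo j) ∷ [] else [])
    entry-lo-lo i j = entry-cong (lo i) (lo j) (cong₂ _<ᵇ_ (toℕ-↑ˡ i n) (toℕ-↑ˡ j n)) (×K₂-lo-lo (star n) i j)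

    entry-hi-hi : ∀ i j → entry (hi i) (hi j) ≡ (if (toℕ i <ᵇ toℕ j) ∧ star n i j then (hi i , hi j) ∷ [] else [])
    entry-hi-hi i j = entry-cong (hi i) (hi j)
      (trans (cong₂ _<ᵇ_ (toℕ-↑ʳ n i) (toℕ-↑ʳ n j)) (<ᵇ-cancel n (toℕ i) (toℕ j))) (×K₂-hi-hi (star n) i j)

    entry-lo-hi : ∀ i j → entry (lo i) (hi j) ≡ (if ⌊ i ≟ j ⌋ then (lo i , hi j) ∷ [] else [])
    entry-lo-hi i j = entry-cong (lo i) (hi j)
      (trans (cong₂ _<ᵇ_ (toℕ-↑ˡ i n) (toℕ-↑ʳ n j)) (<⇒<ᵇ≡true (<-≤-trans (toℕ<n i) (m≤m+n n (toℕ j))))) (×K₂-lo-hi (star n) i j)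

    -- Every index of the second copy exceeds every index of the first, so a rung or the spine is
    -- listed once, from its `lo` end.
    entry-hi-lo : ∀ i j → entry (hi i) (lo j) ≡ []
    entry-hi-lo i j = entry-cong (hi i) (lo j)
      (trans (cong₂ _<ᵇ_ (toℕ-↑ʳ n i) (toℕ-↑ˡ j n)) (≮⇒<ᵇ≡false (<⇒≯ (<-≤-trans (toℕ<n j) (m≤m+n n (toℕ i)))))) (×K₂-hi-lo (star n) i j)

    starRow-centre : ∀ (f : Fin n → Fin n → Edge) →
      cat (λ j → if (toℕ {n} zero <ᵇ toℕ j) ∧ star n zero j then f zero j ∷ [] else []) ≡ tabulate (λ j → f zero (suc j))
    starRow-centre f = cat-singleton (λ j → f zero (suc j))

    starRow-leaf : ∀ (f : Fin n → Fin n → Edge) i →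
      cat (λ j → if (toℕ (suc i) <ᵇ toℕ j) ∧ star n (suc i) j then f (suc i) j ∷ [] else []) ≡ []
    starRow-leaf f i = trans (cat-cong (λ j → cong (if_then f (suc i) (suc j) ∷ [] else []) (∧-zeroʳ (toℕ i <ᵇ toℕ j)))) (cat-[] m)

    row-lo : ∀ i → cat (entry (lo i)) ≡ cat (λ j → if (toℕ i <ᵇ toℕ j) ∧ star n i j then (lo i , lo j) ∷ [] else []) ++ (lo i , hi i) ∷ []
    row-lo i = trans (cat-+ n n (entry (lo i)))
      (cong₂ _++_ (cat-cong (entry-lo-lo i)) (trans (cat-cong (entry-lo-hi i)) (cat-δ i (λ j → lo i , hi j))))

    row-hi : ∀ i → cat (entry (hi i)) ≡ cat (λ j → if (toℕ i <ᵇ toℕ j) ∧ star n i j then (hi i , hi j) ∷ [] else [])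
    row-hi i = trans (cat-+ n n (entry (hi i)))
      (cong₂ _++_ (trans (cat-cong (entry-hi-lo i)) (cat-[] n)) (cat-cong (entry-hi-hi i)))

    -- In index order, the first centre gives its rails and the spine, each leaf beside it a rung,
    -- the second centre its rails, and the remaining leaves nothing. The final `[]` puts the last
    -- block into the form of `count-tabulate-++`.
    edges-S² : edges (S² n) ≡ tabulate railLo ++ spine ∷ tabulate rung ++ tabulate railHi ++ []
    edges-S² = begin
      edges (S² n)
        ≡⟨ trans (concatMap-allFin (λ u → concatMap (entry u) (allFin (n + n)))) (cat-cong (λ u → concatMap-allFin (entry u))) ⟩
      cat (λ u → cat (entry u))
        ≡⟨ cat-+ n n (λ u → cat (entry u)) ⟩
      cat (λ (i : Fin n) → cat (entry (lo i))) ++ cat (λ (i : Fin n) → cat (entry (hi i)))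
        ≡⟨ cong₂ _++_ (cong₂ _++_ row-a (trans (cat-cong rows-a) (cat-singleton rung)))
                      (cong₂ _++_ row-b (trans (cat-cong rows-b) (cat-[] m))) ⟩
      ((tabulate railLo ++ spine ∷ []) ++ tabulate rung) ++ (tabulate railHi ++ [])
        ≡⟨ trans (cong (_++ (tabulate railHi ++ [])) (++-assoc (tabulate railLo) (spine ∷ []) (tabulate rung)))
                 (++-assoc (tabulate railLo) (spine ∷ tabulate rung) (tabulate railHi ++ [])) ⟩
      tabulate railLo ++ spine ∷ tabulate rung ++ tabulate railHi ++ [] ∎
      where
      row-a : cat (entry (lo zero)) ≡ tabulate railLo ++ spine ∷ []
      row-a = trans (row-lo zero) (cong (_++ spine ∷ []) (starRow-centre (λ i j → lo i , lo j)))
      rows-a : ∀ i → cat (entry (lo (suc i))) ≡ rung i ∷ []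
      rows-a i = trans (row-lo (suc i)) (cong (_++ rung i ∷ []) (starRow-leaf (λ i j → lo i , lo j) i))
      row-b : cat (entry (hi zero)) ≡ tabulate railHi
      row-b = trans (row-hi zero) (starRow-centre (λ i j → hi i , hi j))
      rows-b : ∀ i → cat (entry (hi (suc i))) ≡ []
      rows-b i = trans (row-hi (suc i)) (starRow-leaf (λ i j → hi i , hi j) i)

-- Characterisation and number of spanning trees

module SpanningTrees where
  open import Data.Bool using (Bool; true; false; if_then_else_; _∧_; T)
  open import Function using (Equivalence)
  open import Data.Bool.Properties using (∧-zeroʳ; T-≡)
  open import Data.Fin using (Fin; zero; suc; splitAt)
  open import Data.Fin.Properties using (_≟_; splitAt-↑ˡ; splitAt-↑ʳ)
  open import Data.List using (List; []; _∷_; _++_; length; tabulate)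
  open import Data.List.Properties using (length-++)
  open import Data.List.Membership.Propositional using (_∈_)
  open import Data.List.Membership.Propositional.Properties using (∈-++⁺ˡ; ∈-++⁺ʳ)
  open import Data.List.Relation.Unary.All using (All; []; _∷_)
  open import Data.List.Relation.Unary.All.Properties using (++⁺)
  open import Data.List.Relation.Unary.Any using (here)
  open import Data.Nat using (ℕ; zero; suc; _+_; _*_; _^_; _∸_; _≡ᵇ_)
  open import Data.Nat.Properties using (+-suc; +-comm; +-assoc; ≡ᵇ⇒≡)
  open import Data.Nat.Tactic.RingSolver using (solve-∀)
  open import Data.Product using (∃; _×_; _,_; proj₁; proj₂)
  open import Data.Sum using (_⊎_; inj₁; inj₂; [_,_]′)
  open import Data.Vec using (Vec; []; _∷_; lookup)
  open import Relation.Binary.PropositionalEquality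
  open import Relation.Nullary using (yes; no; contradiction)
  open import Relation.Nullary.Decidable using (⌊_⌋)
  open SublistCounting
  open Connectivity
  open EdgeList
  open TwoCopies
  open ≡-Reasoning

  spine? : ∀ m → Bool → List (Fin (suc m + suc m) × Fin (suc m + suc m))
  spine? m s = if s then spine m ∷ [] else []

  module _ {m : ℕ} (s : Bool) (α ρ β : Vec Bool m) where
    private
      n = suc m

    -- Follows the order of `edges-S²`, so that the enumerated sublists have literally this shape.
    chosen : List (Fin (n + n) × Fin (n + n))
    chosen = select (railLo m) α ++ spine? m s ++ select (rung m) ρ ++ select (railHi m) β ++ []

    length-chosen : length chosen ≡ indicator s + (ones α + (ones ρ + ones β))
    length-chosen = begin
      length chosen
        ≡⟨ trans (length-++ (select (railLo m) α)) (cong₂ _+_ (length-select (railLo m) α)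
             (trans (length-++ (spine? m s)) (cong₂ _+_ (length-spine s)
               (trans (length-++ (select (rung m) ρ)) (cong₂ _+_ (length-select (rung m) ρ)
                 (trans (length-++ (select (railHi m) β)) (cong (_+ 0) (length-select (railHi m) β)))))))) ⟩
      ones α + (indicator s + (ones ρ + (ones β + 0)))  ≡⟨ regroup (ones α) (indicator s) (ones ρ) (ones β) ⟩
      indicator s + (ones α + (ones ρ + ones β)) ∎
      where
      length-spine : ∀ s → length (spine? m s) ≡ indicator s
      length-spine false = refl
      length-spine true  = refl
      regroup : ∀ a s r b → a + (s + (r + (b + 0))) ≡ s + (a + (r + b))
      regroup = solve-∀

    railLo-∈ : ∀ i → lookup α i ≡ true → railLo m i ∈ chosen
    railLo-∈ i eq = ∈-++⁺ˡ (select-∈ (railLo m) α i eq)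

    spine-∈ : s ≡ true → spine m ∈ chosen
    spine-∈ refl = ∈-++⁺ʳ (select (railLo m) α) (here refl)

    rung-∈ : ∀ i → lookup ρ i ≡ true → rung m i ∈ chosen
    rung-∈ i eq = ∈-++⁺ʳ (select (railLo m) α) (∈-++⁺ʳ (spine? m s) (∈-++⁺ˡ (select-∈ (rung m) ρ i eq)))

    railHi-∈ : ∀ i → lookup β i ≡ true → railHi m i ∈ chosen
    railHi-∈ i eq = ∈-++⁺ʳ (select (railLo m) α) (∈-++⁺ʳ (spine? m s) (∈-++⁺ʳ (select (rung m) ρ) (∈-++⁺ˡ (select-∈ (railHi m) β i eq))))

    module _ (isSound : sound α ρ β ≡ true) (bridged : s ≡ true ⊎ ∃ λ i → lookup α i ≡ true × lookup ρ i ≡ true × lookup β i ≡ true) where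
      private
        _~_ = Linked chosen
        centre : lo {n} zero ~ hi {n} zero
        centre = [ (λ s≡ → linked-edge chosen (spine-∈ s≡))
                 , (λ (i , a , r , b) → linked-trans chosen (linked-edge chosen (railLo-∈ i a))
                     (linked-trans chosen (linked-edge chosen (rung-∈ i r)) (linked-sym chosen (linked-edge chosen (railHi-∈ i b)))))
                 ]′ bridged

        page : ∀ i → (lo {n} zero ~ lo (suc i)) × (lo {n} zero ~ hi (suc i))
        page i = cases (lookup α i) (lookup ρ i) (lookup β i) refl refl refl (sound-lookup α ρ β isSound i)
          where
          cases : ∀ a r b → lookup α i ≡ a → lookup ρ i ≡ r → lookup β i ≡ b → atLeastTwo a r b ≡ true →
                  (lo {n} zero ~ lo (suc i)) × (lo {n} zero ~ hi (suc i))
          cases true true _ a r _ _ = viaLo , linked-trans chosen viaLo (linked-edge chosen (rung-∈ i r))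
            where viaLo = linked-edge chosen (railLo-∈ i a)
          -- Without its rung the page falls into two halves, and the second leaf is reached through
          -- the other centre.
          cases true false true a _ b _ = linked-edge chosen (railLo-∈ i a) , linked-trans chosen centre (linked-edge chosen (railHi-∈ i b))
          cases false true true _ r b _ = linked-trans chosen viaHi (linked-sym chosen (linked-edge chosen (rung-∈ i r))) , viaHi
            where viaHi = linked-trans chosen centre (linked-edge chosen (railHi-∈ i b))

      sound⇒connected : connectedᵇ chosen ≡ true
      sound⇒connected = linked⇒connectedᵇ chosen (lo {n} zero) linked
        where
        linked : ∀ v → Linked chosen (lo {n} zero) v
        linked v with copy n v
        ... | isLo zero    = linked-refl chosen
        ... | isLo (suc i) = proj₁ (page i)
        ... | isHi zero    = centre
        ... | isHi (suc i) = proj₂ (page i)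

    -- A page with at most one chosen edge has one of its leaves, or both together, cut off;
    -- p and q tell which leaves are on the small side.
    pageCut : Fin m → Bool → Bool → Fin (n + n) → Bool
    pageCut i p q v = [ (λ j → p ∧ ⌊ suc i ≟ j ⌋) , (λ j → q ∧ ⌊ suc i ≟ j ⌋) ]′ (splitAt n v)

    module _ (i : Fin m) (p q : Bool) where
      pageCut-lo : ∀ j → pageCut i p q (lo j) ≡ p ∧ ⌊ suc i ≟ j ⌋
      pageCut-lo j = cong [ (λ j → p ∧ ⌊ suc i ≟ j ⌋) , (λ j → q ∧ ⌊ suc i ≟ j ⌋) ]′ (splitAt-↑ˡ n j n)

      pageCut-hi : ∀ j → pageCut i p q (hi j) ≡ q ∧ ⌊ suc i ≟ j ⌋
      pageCut-hi j = cong [ (λ j → p ∧ ⌊ suc i ≟ j ⌋) , (λ j → q ∧ ⌊ suc i ≟ j ⌋) ]′ (splitAt-↑ʳ n n j)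

      -- Only edges of page `i` could cross the cut: a rail whose leaf is inside, or a rung with
      -- exactly one end inside. The three hypotheses exclude these.
      pageCut-closed : (p ≡ true → lookup α i ≡ false) → (q ≡ true → lookup β i ≡ false) → (lookup ρ i ≡ true → p ≡ q) →
                       All (λ e → pageCut i p q (proj₁ e) ≡ pageCut i p q (proj₂ e)) chosen
      pageCut-closed p⇒ q⇒ r⇒ =
        ++⁺ (select-All (railLo m) α closed-railLo) (++⁺ (closed-spine s) (++⁺ (select-All (rung m) ρ closed-rung)
          (++⁺ (select-All (railHi m) β closed-railHi) [])))
        where
        rail : ∀ (x : Bool) (γ : Vec Bool m) j → (x ≡ true → lookup γ i ≡ false) → lookup γ j ≡ true → x ∧ false ≡ x ∧ ⌊ suc i ≟ suc j ⌋
        rail false γ j _ _ = refl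
        rail true  γ j x⇒ γj with i ≟ j
        ... | no  _    = refl
        ... | yes refl = contradiction (trans (sym (x⇒ refl)) γj) λ ()
        closed-railLo : ∀ j → lookup α j ≡ true → pageCut i p q (lo zero) ≡ pageCut i p q (lo (suc j))
        closed-railLo j αj = trans (pageCut-lo zero) (trans (rail p α j p⇒ αj) (sym (pageCut-lo (suc j))))
        closed-railHi : ∀ j → lookup β j ≡ true → pageCut i p q (hi zero) ≡ pageCut i p q (hi (suc j))
        closed-railHi j βj = trans (pageCut-hi zero) (trans (rail q β j q⇒ βj) (sym (pageCut-hi (suc j))))
        closed-rung : ∀ j → lookup ρ j ≡ true → pageCut i p q (lo (suc j)) ≡ pageCut i p q (hi (suc j))
        closed-rung j ρj = trans (pageCut-lo (suc j)) (trans middle (sym (pageCut-hi (suc j))))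
          where
          middle : p ∧ ⌊ suc i ≟ suc j ⌋ ≡ q ∧ ⌊ suc i ≟ suc j ⌋
          middle with i ≟ j
          ... | no  _    = trans (∧-zeroʳ p) (sym (∧-zeroʳ q))
          ... | yes refl = cong (_∧ true) (r⇒ ρj)
        closed-spine : ∀ s → All (λ e → pageCut i p q (proj₁ e) ≡ pageCut i p q (proj₂ e)) (spine? m s)
        closed-spine false = []
        closed-spine true  = trans (pageCut-lo zero) (trans (trans (∧-zeroʳ p) (sym (∧-zeroʳ q))) (sym (pageCut-hi zero))) ∷ []

    unsound⇒disconnected : sound α ρ β ≡ false → connectedᵇ chosen ≡ false
    unsound⇒disconnected unsound with i , few ← unsound-lookup α ρ β unsound =
      cases (lookup α i) (lookup ρ i) (lookup β i) refl refl refl few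
      where
      separate : ∀ i p q v → pageCut i p q v ≡ true →
                 (p ≡ true → lookup α i ≡ false) → (q ≡ true → lookup β i ≡ false) → (lookup ρ i ≡ true → p ≡ q) → connectedᵇ chosen ≡ false
      separate i p q v inside p⇒ q⇒ r⇒ = cut⇒disconnected chosen (pageCut i p q) (pageCut-closed i p q p⇒ q⇒ r⇒) v (lo zero) inside
        (trans (pageCut-lo i p q zero) (∧-zeroʳ p))
      inLo : ∀ i q → pageCut i true q (lo (suc i)) ≡ true
      inLo i q = trans (pageCut-lo i true q (suc i)) (⌊≟⌋-refl (suc i))
      inHi : ∀ i p → pageCut i p true (hi (suc i)) ≡ true
      inHi i p = trans (pageCut-hi i p true (suc i)) (⌊≟⌋-refl (suc i))
      cases : ∀ {i} a r b → lookup α i ≡ a → lookup ρ i ≡ r → lookup β i ≡ b → atLeastTwo a r b ≡ false → connectedᵇ chosen ≡ false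
      -- With both rails missing the two leaves are cut off together, whatever the rung. In the
      -- other cases the rung and one rail are missing, and the leaf of that rail is isolated.
      cases {i} false r false a _ b _ = separate i true true (lo (suc i)) (inLo i true) (λ _ → a) (λ _ → b) (λ _ → refl)
      cases {i} false false true a r _ _ = separate i true false (lo (suc i)) (inLo i false) (λ _ → a) (λ ()) (λ r′ → contradiction (trans (sym r) r′) λ ())
      cases {i} true false false _ r b _ = separate i false true (hi (suc i)) (inHi i false) (λ ()) (λ _ → b) (λ r′ → contradiction (trans (sym r) r′) λ ())

    -- `m + n` is what `N ∸ 1` reduces to for N = n + n. The pages account for 2m of these 2m + 1
    -- edges, and the spine and the full pages compete for the last.
    length-sound : sound α ρ β ≡ true → (length chosen ≡ᵇ m + n) ≡ (indicator s + full α ρ β ≡ᵇ 1)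
    length-sound isSound = begin
      (length chosen ≡ᵇ m + n)                                           ≡⟨ cong₂ _≡ᵇ_ length-chosen (+-suc m m) ⟩
      (indicator s + (ones α + (ones ρ + ones β)) ≡ᵇ suc (m + m))        ≡⟨ cong (λ x → indicator s + x ≡ᵇ suc (m + m)) (sound-ones α ρ β isSound) ⟩
      (indicator s + (full α ρ β + (m + m)) ≡ᵇ suc (m + m))
        ≡⟨ cong₂ _≡ᵇ_ (trans (sym (+-assoc (indicator s) (full α ρ β) (m + m))) (+-comm (indicator s + full α ρ β) (m + m))) (+-comm 1 (m + m)) ⟩
      ((m + m) + (indicator s + full α ρ β) ≡ᵇ (m + m) + 1)              ≡⟨ ≡ᵇ-cancel (m + m) (indicator s + full α ρ β) 1 ⟩
      (indicator s + full α ρ β ≡ᵇ 1)                                    ∎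
      where
      ≡ᵇ-cancel : ∀ k x y → (k + x ≡ᵇ k + y) ≡ (x ≡ᵇ y)
      ≡ᵇ-cancel zero    x y = refl
      ≡ᵇ-cancel (suc k) x y = ≡ᵇ-cancel k x y

    -- Soundness alone need not join the centres; the edge count supplies this, since the one extra
    -- edge is the spine or completes a page. Any other count fails the length test.
    isSpanningTree≡ : isSpanningTreeᵇ chosen ≡ sound α ρ β ∧ (indicator s + full α ρ β ≡ᵇ 1)
    isSpanningTree≡ with sound α ρ β in isSound
    ... | false = trans (cong ((length chosen ≡ᵇ m + n) ∧_) (unsound⇒disconnected isSound)) (∧-zeroʳ (length chosen ≡ᵇ m + n))
    ... | true  with indicator s + full α ρ β ≡ᵇ 1 in one
    ...   | false = cong (_∧ connectedᵇ chosen) (trans (length-sound isSound) one)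
    ...   | true  = cong₂ _∧_ (trans (length-sound isSound) one) (sound⇒connected isSound (bridge s refl))
      where
      bridge : ∀ b → s ≡ b → s ≡ true ⊎ ∃ λ i → lookup α i ≡ true × lookup ρ i ≡ true × lookup β i ≡ true
      bridge true  eq = inj₁ eq
      bridge false eq = inj₂ (full-lookup α ρ β (≡ᵇ⇒≡ (full α ρ β) 1 (subst (λ b → T (indicator b + full α ρ β ≡ᵇ 1)) eq (Equivalence.from T-≡ one))))

  numberOfSpanningTrees : ∀ k → τ (S² (suc (suc k))) ≡ (suc (suc k) + 2) * 3 ^ k
  numberOfSpanningTrees k = begin
    count P (edges (S² (suc m)))                                        ≡⟨ cong (count P) (edges-S² m) ⟩
    count P (tabulate (railLo m) ++ rest)                               ≡⟨ count-tabulate-++ P (railLo m) rest ⟩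
    maskSum m (λ α → count (λ T → P (select (railLo m) α ++ T)) rest)   ≡⟨ maskSum-cong m (λ α → count-∷ (λ T → P (select (railLo m) α ++ T)) (spine m) (tabulate (rung m) ++ tabulate (railHi m) ++ [])) ⟩
    maskSum m (λ α → tail α false + tail α true)                        ≡⟨ maskSum-+ m (λ α → tail α false) (λ α → tail α true) ⟩
    maskSum m (λ α → tail α false) + maskSum m (λ α → tail α true)      ≡⟨ cong₂ _+_ (expand false) (expand true) ⟩
    -- Without the spine one page is full. With it, `1 + full α ρ β ≡ᵇ 1` reduces to
    -- `full α ρ β ≡ᵇ 0`, so none is.
    soundWithFull m 1 + soundWithFull m 0                               ≡⟨ cong₂ _+_ (soundWithFull-1 k) (soundWithFull-0 m) ⟩
    suc k * 3 ^ k + 3 * 3 ^ k                                           ≡⟨ regroup k (3 ^ k) ⟩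
    (suc (suc k) + 2) * 3 ^ k                                           ∎
    where
    m = suc k
    P = isSpanningTreeᵇ {suc m + suc m}
    rest = spine m ∷ tabulate (rung m) ++ tabulate (railHi m) ++ []
    tail : Vec Bool m → Bool → ℕ
    tail α s = count (λ T → P (select (railLo m) α ++ spine? m s ++ T)) (tabulate (rung m) ++ tabulate (railHi m) ++ [])
    expand : ∀ s → maskSum m (λ α → tail α s) ≡ maskSum³ m (λ α ρ β → indicator (sound α ρ β ∧ (indicator s + full α ρ β ≡ᵇ 1)))
    expand s = maskSum-cong m (λ α →
      trans (count-tabulate-++ (λ T → P (select (railLo m) α ++ spine? m s ++ T)) (rung m) (tabulate (railHi m) ++ []))
        (maskSum-cong m (λ ρ →
          trans (count-tabulate-++ (λ T → P (select (railLo m) α ++ spine? m s ++ select (rung m) ρ ++ T)) (railHi m) [])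
            (maskSum-cong m (λ β →
              trans (count-[] (λ T → P (select (railLo m) α ++ spine? m s ++ select (rung m) ρ ++ select (railHi m) β ++ T)))
                (cong indicator (isSpanningTree≡ s α ρ β)))))))
    regroup : ∀ k p → suc k * p + 3 * p ≡ (suc (suc k) + 2) * p
    regroup = solve-∀

open import Data.Nat using (ℕ; _≤_; _+_; _*_; _^_; _∸_; suc; s≤s)
open import Data.Integer using (+_; -[1+_])
open import Data.Rational using (ℚ; 0ℚ; _<_; ∣_∣; _-_; _/_)
import Data.Integer as ℤ
open import Data.Product using (_×_; ∃; _,_)
open import Relation.Binary.PropositionalEquality using (_≡_)

theorem3p1 : ((n : ℕ) → 2 ≤ n →
    IsKirchhoffIndex (S² n) ((+ (8 * n ^ 3 + 3 * n ^ 2 + 12) ℤ.- + (14 * n)) / (6 + 3 * n))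
    × τ (S² n) ≡ (n + 2) * 3 ^ (n ∸ 2))
    × ((ε : ℚ) → 0ℚ < ε → ∃ λ (N₀ : ℕ) → (n : ℕ) → N₀ ≤ n → (k : ℚ) → (w : ℕ) →
    IsKirchhoffIndex (S² n) k → IsWienerIndex (S² n) w →
    ∣ (k ÷ℕ w) - (+ 8 / 15) ∣ < ε)
theorem3p1 = formulas , Limit.ratio-limit
  where
  formulas : (n : ℕ) → 2 ≤ n →
    IsKirchhoffIndex (S² n) ((+ (8 * n ^ 3 + 3 * n ^ 2 + 12) ℤ.- + (14 * n)) / (6 + 3 * n))
    × τ (S² n) ≡ (n + 2) * 3 ^ (n ∸ 2)
  -- Two successors guarantee at least one page and let `n ∸ 2` reduce to `k`.
  formulas (suc (suc k)) (s≤s (s≤s _)) = KirchhoffIndex.S²-isKirchhoffIndex (suc k) , SpanningTrees.numberOfSpanningTrees k
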